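{- Let $d\geq 3$ be an odd integer and let $n$ be a positive integer with $n\equiv -1\pmod d$. Then \[ \sum_{k=0}^{n-1}\frac{(q^{d+1};q^d)_k^{d-2}(q;q^d)_k^2\,q^{dk}}{(q^d;q^d)_k^d} \equiv \frac{(1-q)^2(q^d;q^d)_{n-1-(n+1)/d}}{(q^d;q^d)_{(n+1)/d}^{d-1}}\,q^{(d(d+n)(n+1)-(n+1)^2)/(2d)-2}\pmod{\Phi_n(q)^2}. \]
   Context: For a complex variable $x$ and integer $m\ge 0$, $(x;q)_m=(1-x)(1-xq)\cdots(1-xq^{m-1})$, with $(x;q)_0=1$; $(x;q)_m^e$ denotes its $e$-th power. $\Phi_n(q)$ is the $n$-th cyclotomic polynomial. For rational functions $A(q),B(q)$ and a polynomial $P(q)$, $A\equiv B\pmod{P(q)}$ means that $(A-B)/P$ is a rational function whose denominator is coprime to $P(q)$. -}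

module Defs where

open import Data.Nat as ℕ using (ℕ; zero; suc; _+_; _*_; _∸_; _^_)
open import Data.Nat.Divisibility using (_∣?_)
open import Data.Rational as ℚ using (ℚ; 0ℚ; 1ℚ)
open import Data.List using (List; []; _∷_; upTo; foldr; filter; map)
open import Data.Product using (Σ; _×_; _,_)
open import Relation.Binary.PropositionalEquality using (_≡_)

-- Polynomials in q over ℚ: little-endian coefficient lists.

Poly : Set
Poly = List ℚ

coeff : Poly → ℕ → ℚ
coeff [] _ = 0ℚ
coeff (a ∷ p) zero = a
coeff (a ∷ p) (suc i) = coeff p i

-- polynomial equality (ignores trailing zero coefficients)
infix 4 _≈ₚ_
_≈ₚ_ : Poly → Poly → Set
p ≈ₚ r = ∀ i → coeff p i ≡ coeff r i

infixl 6 _+ₚ_ _-ₚ_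
infixl 7 _*ₚ_
infixr 8 _^ₚ_

_+ₚ_ : Poly → Poly → Poly
[] +ₚ r = r
(a ∷ p) +ₚ [] = a ∷ p
(a ∷ p) +ₚ (b ∷ r) = (a ℚ.+ b) ∷ (p +ₚ r)

scaleₚ : ℚ → Poly → Poly
scaleₚ c = map (c ℚ.*_)

-ₚ_ : Poly → Poly
-ₚ p = map ℚ.-_ p

_-ₚ_ : Poly → Poly → Poly
p -ₚ r = p +ₚ (-ₚ r)

_*ₚ_ : Poly → Poly → Poly
[] *ₚ r = []
(a ∷ p) *ₚ r = scaleₚ a r +ₚ (0ℚ ∷ (p *ₚ r))

oneₚ : Poly
oneₚ = 1ℚ ∷ []

qPow : ℕ → Poly
qPow zero = oneₚ
qPow (suc k) = 0ℚ ∷ qPow k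

_^ₚ_ : Poly → ℕ → Poly
p ^ₚ zero = oneₚ
p ^ₚ suc e = p *ₚ (p ^ₚ e)

prodₚ : List Poly → Poly
prodₚ = foldr _*ₚ_ oneₚ

qPoch : ℕ → ℕ → ℕ → Poly
qPoch a b zero = oneₚ
qPoch a b (suc m) = qPoch a b m *ₚ (oneₚ -ₚ qPow (a + b * m))

-- Cyclotomic polynomials, characterised by  ∏_{e ∣ m} Φ_e(q) = q^m - 1
-- for every m ≥ 1 (this determines each Φ_m uniquely in ℚ[q]).

divisors : ℕ → List ℕ
divisors m = filter (λ e → e ∣? m) (upTo (suc m))

IsCyclotomicFamily : (ℕ → Poly) → Set
IsCyclotomicFamily Φ =
  ∀ m → 1 ℕ.≤ m → prodₚ (map Φ (divisors m)) ≈ₚ qPow m -ₚ oneₚ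

record Frac : Set where
  constructor _/ₚ_
  field
    num : Poly
    den : Poly
open Frac public

_+f_ : Frac → Frac → Frac
(a /ₚ b) +f (c /ₚ e) = ((a *ₚ e) +ₚ (c *ₚ b)) /ₚ (b *ₚ e)

zeroF : Frac
zeroF = [] /ₚ oneₚ

sumF : ℕ → (ℕ → Frac) → Frac
sumF zero f = zeroF
sumF (suc n) f = sumF n f +f f n

Coprime : Poly → Poly → Set
Coprime V P = Σ Poly λ a → Σ Poly λ b → a *ₚ V +ₚ b *ₚ P ≈ₚ oneₚ

-- A ≡ B (mod P): (A - B)/P = U/V for polynomials U, V with V coprime to P.
CongMod : Frac → Frac → Poly → Set
CongMod A B P =
  Σ Poly λ U → Σ Poly λ V → Coprime V P ×
    ((num A *ₚ den B -ₚ num B *ₚ den A) *ₚ V ≈ₚ P *ₚ U *ₚ den A *ₚ den B)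

-- natural-number division (total; only used with nonzero divisor)
_div_ : ℕ → ℕ → ℕ
m div zero = zero
m div suc k = m ℕ./ suc k

lhsTerm : ℕ → ℕ → Frac
lhsTerm d k =
  (qPoch (d + 1) d k ^ₚ (d ∸ 2) *ₚ qPoch 1 d k ^ₚ 2 *ₚ qPow (d * k))
  /ₚ (qPoch d d k ^ₚ d)

lhs : ℕ → ℕ → Frac
lhs d n = sumF n (lhsTerm d)

rhsExp : ℕ → ℕ → ℕ
rhsExp d n = ((d * (d + n) * (n + 1) ∸ (n + 1) ^ 2) div (2 * d)) ∸ 2

rhs : ℕ → ℕ → Frac
rhs d n =
  ((oneₚ -ₚ qPow 1) ^ₚ 2 *ₚ qPoch d d (n ∸ 1 ∸ ((n + 1) div d)) *ₚ qPow (rhsExp d n))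
  /ₚ (qPoch d d ((n + 1) div d) ^ₚ (d ∸ 1))

{-# OPTIONS --safe #-}
module Submission where

-- Put p = q^d, m = (n + 1)/d and ε = q^n − 1, so that ε² = 0 modulo Φₙ². The summand depends on d
-- Pochhammer parameters; scaling each by 1 + tᵢ ε changes it by a first-order term. With d − 1 weights
-- tᵢ = 1 and one weight 1 − d every parameter becomes an exact power of p (q(1 + ε) = p^m, and
-- q(1 − (d − 1)ε) is the inverse of p^(n − m)), so the sum terminates and is of Karlsson–Minton type:
-- a sum of (y; p)_k / (p; p)_k p^k f(p^k) with y p^M = 1 and deg f = M, which picks out the leading
-- coefficient of f. The weight 1 − d can be put on one of the two parameters q or on one of the d − 2
-- parameters q p; in the combination of the two with weights 2 and d − 2 the first-order terms cancel,
-- which determines d times the sum modulo Φₙ².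

-- The weights sum to zero, but this alone does not remove the first-order term, because the
-- parameters q and q p have different derivatives. Averaging over all d positions of the weight 1 -
-- d does: each parameter then receives weight 1 in d - 1 cases and weight 1 - d in one. Two
-- positions carry q and d - 2 carry q p, whence the weights 2 and d - 2, whose total d is
-- invertible over ℚ. The argument runs in ℚ[q] modulo Φₙ², where ε is nilpotent, so every division
-- must be by a unit. The factors 1 - q^(dj) with 0 < j < n are units: as d m = n + 1, they divide
-- q^j - 1 modulo Φₙ, which is a unit because Φₙ is comaximal with q^g - 1 for each proper divisor g
-- of n; inverses modulo Φₙ lift to Φₙ². After the sums are evaluated, the leading coefficients
-- combine to a power with exponent d - 1. For odd d this exponent is even, so the sign disappears.
-- What is left still depends on ε through p^m and p^(n - m); clearing the reciprocals of q in it
-- costs q², the source of the -2 in the exponent, and the first-order terms cancel a second time.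

open import Defs
open import Algebra using (CommutativeRing)
import Algebra.Properties.CommutativeSemiring.Exp as CommutativeExp
import Algebra.Properties.Semiring.Exp as Exp
import Algebra.Properties.Semiring.Mult as Mult
import Algebra.Solver.Ring
open import Algebra.Solver.Ring.AlmostCommutativeRing
  using (_-Raw-AlmostCommutative⟶_; fromCommutativeRing)
open import Data.Integer as ℤ using (ℤ; +_; -[1+_])
import Data.Integer.Properties as ℤ
open import Data.List using (List; []; _∷_; _++_; length; map; filter; upTo)
open import Data.List.Properties
  using (length-++; filter-++; map-++; upTo-∷ʳ; filter-accept; filter-reject)
open import Data.Maybe using (Maybe; just; nothing)
open import Data.Nat as ℕ using (ℕ; zero; suc; s≤s; z≤n; _≤_)
open import Data.Nat.Divisibility as ℕ using (_∣_; _∣?_; divides)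
import Data.Nat.DivMod as ℕ
open import Data.Nat.GCD using (gcd; gcd[m,n]∣m; gcd[m,n]∣n; gcd-GCD; gcd[m,n]≢0; module Bézout)
import Data.Nat.Properties as ℕ
open import Data.Nat.Tactic.RingSolver using () renaming (solve-∀ to ℕ-solve-∀)
open import Data.Product using (∃; _,_; _×_; proj₁; proj₂)
open import Data.Rational as ℚ using (ℚ; 0ℚ; 1ℚ)
import Data.Rational.Properties as ℚ
open import Data.Sum using (_⊎_; inj₁; inj₂)
open import Level using (_⊔_; 0ℓ)
import Relation.Binary.PropositionalEquality as ≡
open ≡ using (_≡_)
open import Relation.Nullary using (¬_; yes; no; contradiction)

-- With coefficients in ℤ the solver can cancel terms although equality in R is undecidable.
module ℤ-Solver {c ℓ} (R : CommutativeRing c ℓ) where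
  open CommutativeRing R
  open import Algebra.Properties.Ring ring
  open import Algebra.Properties.AbelianGroup +-abelianGroup using (⁻¹-∙-comm)
  open import Algebra.Properties.Semiring.Mult.TCOptimised semiring renaming (_×_ to _·_)
  open import Relation.Binary.Reasoning.Setoid setoid

  ⟦_⟧ᶻ : ℤ → Carrier
  ⟦ + n ⟧ᶻ = n · 1#
  ⟦ -[1+ n ] ⟧ᶻ = - (suc n · 1#)

  neg-homo : ∀ z → ⟦ ℤ.- z ⟧ᶻ ≈ - ⟦ z ⟧ᶻ
  neg-homo (+ zero) = sym -0#≈0#
  neg-homo (+ suc n) = refl
  neg-homo -[1+ n ] = sym (-‿involutive _)

  ×-suc : ∀ n → suc n · 1# ≈ 1# + n · 1#
  ×-suc n = ×-homo-+ 1# 1 n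

  ⊖-homo : ∀ m n → ⟦ m ℤ.⊖ n ⟧ᶻ ≈ m · 1# - n · 1#
  ⊖-homo m zero = sym (trans (+-congˡ -0#≈0#) (+-identityʳ _))
  ⊖-homo zero (suc n) = sym (+-identityˡ _)
  ⊖-homo (suc m) (suc n) = begin
    ⟦ suc m ℤ.⊖ suc n ⟧ᶻ              ≡⟨ ≡.cong ⟦_⟧ᶻ (ℤ.[1+m]⊖[1+n]≡m⊖n m n) ⟩
    ⟦ m ℤ.⊖ n ⟧ᶻ                      ≈⟨ ⊖-homo m n ⟩
    m · 1# - n · 1#                   ≈⟨ +-congʳ (+-identityʳ _) ⟨
    (m · 1# + 0#) - n · 1#            ≈⟨ +-congʳ (+-congˡ (-‿inverseʳ 1#)) ⟨
    (m · 1# + (1# - 1#)) - n · 1#     ≈⟨ +-congʳ (+-assoc _ _ _) ⟨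
    ((m · 1# + 1#) - 1#) - n · 1#     ≈⟨ +-assoc _ _ _ ⟩
    (m · 1# + 1#) + (- 1# - n · 1#)   ≈⟨ +-cong (+-comm _ _) (⁻¹-∙-comm _ _) ⟩
    (1# + m · 1#) - (1# + n · 1#)     ≈⟨ +-cong (×-suc m) (-‿cong (×-suc n)) ⟨
    suc m · 1# - suc n · 1#           ∎

  +-homo : ∀ x y → ⟦ x ℤ.+ y ⟧ᶻ ≈ ⟦ x ⟧ᶻ + ⟦ y ⟧ᶻ
  +-homo (+ m) (+ n) = ×-homo-+ 1# m n
  +-homo (+ m) -[1+ n ] = ⊖-homo m (suc n)
  +-homo -[1+ m ] (+ n) = trans (⊖-homo n (suc m)) (+-comm _ _)
  +-homo -[1+ m ] -[1+ n ] = begin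
    - (suc (suc (m ℕ.+ n)) · 1#)       ≡⟨ ≡.cong (λ k → - (k · 1#)) (≡.sym (≡.cong suc (ℕ.+-suc m n))) ⟩
    - ((suc m ℕ.+ suc n) · 1#)         ≈⟨ -‿cong (×-homo-+ 1# (suc m) (suc n)) ⟩
    - (suc m · 1# + suc n · 1#)        ≈⟨ ⁻¹-∙-comm _ _ ⟨
    - (suc m · 1#) - suc n · 1#        ∎

  *-homo : ∀ x y → ⟦ x ℤ.* y ⟧ᶻ ≈ ⟦ x ⟧ᶻ * ⟦ y ⟧ᶻ
  *-homo⁺ : ∀ m y → ⟦ + m ℤ.* y ⟧ᶻ ≈ ⟦ + m ⟧ᶻ * ⟦ y ⟧ᶻ
  *-homo⁺ m (+ n) = trans (reflexive (≡.cong ⟦_⟧ᶻ (≡.sym (ℤ.pos-* m n)))) (×1-homo-* m n)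
  *-homo⁺ m -[1+ n ] = begin
    ⟦ + m ℤ.* -[1+ n ] ⟧ᶻ         ≡⟨ ≡.cong ⟦_⟧ᶻ (ℤ.neg-distribʳ-* (+ m) (+ suc n)) ⟨
    ⟦ ℤ.- (+ m ℤ.* + suc n) ⟧ᶻ    ≈⟨ neg-homo (+ m ℤ.* + suc n) ⟩
    - ⟦ + m ℤ.* + suc n ⟧ᶻ        ≈⟨ -‿cong (*-homo⁺ m (+ suc n)) ⟩
    - (m · 1# * (suc n · 1#))     ≈⟨ -‿distribʳ-* _ _ ⟩
    m · 1# * - (suc n · 1#)       ∎
  *-homo (+ m) y = *-homo⁺ m y
  *-homo -[1+ m ] y = begin
    ⟦ -[1+ m ] ℤ.* y ⟧ᶻ           ≡⟨ ≡.cong ⟦_⟧ᶻ (ℤ.neg-distribˡ-* (+ suc m) y) ⟨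
    ⟦ ℤ.- (+ suc m ℤ.* y) ⟧ᶻ      ≈⟨ neg-homo (+ suc m ℤ.* y) ⟩
    - ⟦ + suc m ℤ.* y ⟧ᶻ          ≈⟨ -‿cong (*-homo⁺ (suc m) y) ⟩
    - (suc m · 1# * ⟦ y ⟧ᶻ)       ≈⟨ -‿distribˡ-* _ _ ⟩
    - (suc m · 1#) * ⟦ y ⟧ᶻ       ∎

  private
    dec : ∀ x y → Maybe (⟦ x ⟧ᶻ ≈ ⟦ y ⟧ᶻ)
    dec x y with x ℤ.≟ y
    ... | yes x≡y = just (reflexive (≡.cong ⟦_⟧ᶻ x≡y))
    ... | no _ = nothing

  homomorphism : CommutativeRing.rawRing ℤ.+-*-commutativeRing -Raw-AlmostCommutative⟶ fromCommutativeRing R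
  homomorphism = record
    { ⟦_⟧ = ⟦_⟧ᶻ ; +-homo = +-homo ; *-homo = *-homo ; -‿homo = neg-homo ; 0-homo = refl ; 1-homo = refl }

  open Algebra.Solver.Ring _ _ homomorphism dec public
    using (solve; _:=_; _:+_; _:*_; _:-_; :-_; con; Polynomial)

  :0 :1 : ∀ {n} → Polynomial n
  :0 = con (+ 0)
  :1 = con (+ 1)

-- Pochhammer symbols and Karlsson–Minton sums

module Sums {c ℓ} (R : CommutativeRing c ℓ) where
  open CommutativeRing R
  open ℤ-Solver R
  open import Relation.Binary.Reasoning.Setoid setoid

  sum : ℕ → (ℕ → Carrier) → Carrier
  sum zero f = 0#
  sum (suc n) f = sum n f + f n

  sum-cong : ∀ n {f g} → (∀ k → k ℕ.< n → f k ≈ g k) → sum n f ≈ sum n g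
  sum-cong zero f≈g = refl
  sum-cong (suc n) f≈g =
    +-cong (sum-cong n (λ k k<n → f≈g k (ℕ.m<n⇒m<1+n k<n))) (f≈g n ℕ.≤-refl)

  sum-linear : ∀ n a b f g → sum n (λ k → a * f k + b * g k) ≈ a * sum n f + b * sum n g
  sum-linear zero a b f g = solve 2 (λ a b → :0 := a :* :0 :+ b :* :0) refl a b
  sum-linear (suc n) a b f g = trans (+-congʳ (sum-linear n a b f g))
    (solve 6 (λ a b s t x y → (a :* s :+ b :* t) :+ (a :* x :+ b :* y) := a :* (s :+ x) :+ b :* (t :+ y))
      refl a b (sum n f) (sum n g) (f n) (g n))

  sum-*ˡ : ∀ n a f → sum n (λ k → a * f k) ≈ a * sum n f
  sum-*ˡ zero a f = sym (zeroʳ a)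
  sum-*ˡ (suc n) a f = trans (+-congʳ (sum-*ˡ n a f)) (sym (distribˡ a _ _))

module Pochhammer {c ℓ} (R : CommutativeRing c ℓ) where
  open CommutativeRing R
  open import Algebra.Properties.Semiring.Exp semiring using (_^_; ^-homo-*)
  open ℤ-Solver R
  open Sums R
  open import Relation.Binary.Reasoning.Setoid setoid

  poch : Carrier → Carrier → ℕ → Carrier
  poch x p zero = 1#
  poch x p (suc k) = poch x p k * (1# - x * p ^ k)

  poch-cong : ∀ {x y} p k → x ≈ y → poch x p k ≈ poch y p k
  poch-cong p zero x≈y = refl
  poch-cong p (suc k) x≈y = *-cong (poch-cong p k x≈y) (+-congˡ (-‿cong (*-congʳ x≈y)))

  poch-suc : ∀ x p k → poch x p (suc k) ≈ (1# - x) * poch (x * p) p k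
  poch-suc x p zero = solve 1 (λ x → :1 :* (:1 :- x :* :1) := (:1 :- x) :* :1) refl x
  poch-suc x p (suc k) = trans (*-congʳ (poch-suc x p k))
    (solve 4 (λ x p P B → (:1 :- x) :* P :* (:1 :- x :* (p :* B)) := (:1 :- x) :* (P :* (:1 :- x :* p :* B)))
      refl x p (poch (x * p) p k) (p ^ k))

  poch-+ : ∀ x p m k → poch x p (m ℕ.+ k) ≈ poch x p m * poch (x * p ^ m) p k
  poch-+ x p m zero = trans (reflexive (≡.cong (poch x p) (ℕ.+-identityʳ m))) (sym (*-identityʳ _))
  poch-+ x p m (suc k) = begin
    poch x p (m ℕ.+ suc k)                                              ≡⟨ ≡.cong (poch x p) (ℕ.+-suc m k) ⟩
    poch x p (m ℕ.+ k) * (1# - x * p ^ (m ℕ.+ k))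
      ≈⟨ *-cong (poch-+ x p m k) (+-congˡ (-‿cong (trans (*-congˡ (^-homo-* p m k)) (sym (*-assoc _ _ _))))) ⟩
    poch x p m * poch (x * p ^ m) p k * (1# - x * p ^ m * p ^ k)        ≈⟨ *-assoc _ _ _ ⟩
    poch x p m * (poch (x * p ^ m) p k * (1# - x * p ^ m * p ^ k))      ∎

  -- Both sides are `(p; p)_(m + k)`. The swap trades a product of length `k` for one of length `m`,
  -- which is a polynomial in `p ^ k`.
  poch-swap : ∀ p m k → poch p p m * poch (p * p ^ m) p k ≈ poch p p k * poch (p * p ^ k) p m
  poch-swap p m k = begin
    poch p p m * poch (p * p ^ m) p k   ≈⟨ poch-+ p p m k ⟨
    poch p p (m ℕ.+ k)                  ≡⟨ ≡.cong (poch p p) (ℕ.+-comm m k) ⟩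
    poch p p (k ℕ.+ m)                  ≈⟨ poch-+ p p k m ⟩
    poch p p k * poch (p * p ^ k) p m   ∎

  poch-root : ∀ x p {j k} → x * p ^ j ≈ 1# → j ℕ.< k → poch x p k ≈ 0#
  poch-root x p {j} {suc k} xpʲ≈1 j<1+k with ℕ.m≤n⇒m<n∨m≡n (ℕ.s≤s⁻¹ j<1+k)
  ... | inj₁ j<k = trans (*-congʳ (poch-root x p xpʲ≈1 j<k)) (zeroˡ _)
  ... | inj₂ ≡.refl = trans (*-congˡ (trans (+-congˡ (-‿cong xpʲ≈1)) (-‿inverseʳ 1#))) (zeroʳ _)

  -- A list cs encodes the polynomial ∏ (1 − c X) over c in cs.

  eval : List Carrier → Carrier → Carrier
  eval [] X = 1#
  eval (c ∷ cs) X = (1# - c * X) * eval cs X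

  lead : List Carrier → Carrier
  lead [] = 1#
  lead (c ∷ cs) = - c * lead cs

  eval-++ : ∀ cs ds X → eval (cs ++ ds) X ≈ eval cs X * eval ds X
  eval-++ [] ds X = sym (*-identityˡ _)
  eval-++ (c ∷ cs) ds X = trans (*-congˡ (eval-++ cs ds X)) (sym (*-assoc _ _ _))

  lead-++ : ∀ cs ds → lead (cs ++ ds) ≈ lead cs * lead ds
  lead-++ [] ds = sym (*-identityˡ _)
  lead-++ (c ∷ cs) ds = trans (*-congˡ (lead-++ cs ds)) (sym (*-assoc _ _ _))

  copies : ℕ → List Carrier → List Carrier
  copies zero cs = []
  copies (suc e) cs = cs ++ copies e cs

  eval-copies : ∀ e cs X → eval (copies e cs) X ≈ eval cs X ^ e
  eval-copies zero cs X = refl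
  eval-copies (suc e) cs X = trans (eval-++ cs (copies e cs) X) (*-congˡ (eval-copies e cs X))

  lead-copies : ∀ e cs → lead (copies e cs) ≈ lead cs ^ e
  lead-copies zero cs = refl
  lead-copies (suc e) cs = trans (lead-++ cs (copies e cs)) (*-congˡ (lead-copies e cs))

  length-copies : ∀ e cs → length (copies e cs) ≡ e ℕ.* length cs
  length-copies zero cs = ≡.refl
  length-copies (suc e) cs = ≡.trans (length-++ cs) (≡.cong (length cs ℕ.+_) (length-copies e cs))

  powers : Carrier → ℕ → List Carrier
  powers p zero = []
  powers p (suc m) = p ^ suc m ∷ powers p m

  length-powers : ∀ p m → length (powers p m) ≡ m
  length-powers p zero = ≡.refl
  length-powers p (suc m) = ≡.cong suc (length-powers p m)

  eval-powers : ∀ p m X → eval (powers p m) X ≈ poch (p * X) p m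
  eval-powers p zero X = refl
  eval-powers p (suc m) X = trans (*-congˡ (eval-powers p m X))
    (solve 4 (λ p B X P → (:1 :- p :* B :* X) :* P := P :* (:1 :- p :* X :* B))
      refl p (p ^ m) X (poch (p * X) p m))

  -- The coefficient itself is (-1)^m p^(m(m+1)/2). Its square has neither the sign nor the halved
  -- exponent, and only even powers of it enter the final value.
  lead-powers² : ∀ p m → lead (powers p m) * lead (powers p m) ≈ p ^ (m ℕ.* suc m)
  lead-powers² p zero = *-identityˡ 1#
  lead-powers² p (suc m) = begin
    - P * L * (- P * L)                          ≈⟨ solve 2 (λ P L → :- P :* L :* (:- P :* L) := P :* P :* (L :* L)) refl P L ⟩
    P * P * (L * L)                              ≈⟨ *-cong (sym (^-homo-* p (suc m) (suc m))) (lead-powers² p m) ⟩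
    p ^ (suc m ℕ.+ suc m) * p ^ (m ℕ.* suc m)    ≈⟨ ^-homo-* p (suc m ℕ.+ suc m) (m ℕ.* suc m) ⟨
    p ^ (suc m ℕ.+ suc m ℕ.+ m ℕ.* suc m)        ≡⟨ ≡.cong (p ^_) arith ⟩
    p ^ (suc m ℕ.* suc (suc m))                  ∎
    where
    P = p ^ suc m
    L = lead (powers p m)
    arith : suc m ℕ.+ suc m ℕ.+ m ℕ.* suc m ≡ suc m ℕ.* suc (suc m)
    arith = ≡.trans (ℕ.+-assoc (suc m) (suc m) _) (ℕ.*-comm (suc (suc m)) (suc m))

  -- The bound `K` is essential: in the application it is n - 1, and 1 - p^n is nilpotent there, so
  -- `(p; p)_k` has an inverse only for smaller `k`.
  module KarlssonMinton (p : Carrier) (K : ℕ) (inv : ℕ → Carrier)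
    (inverse : ∀ k → k ℕ.≤ K → poch p p k * inv k ≈ 1#) where

    inv-suc : ∀ k → suc k ℕ.≤ K → inv k ≈ (1# - p * p ^ k) * inv (suc k)
    inv-suc k k<K = begin
      inv k                                                      ≈⟨ *-identityʳ _ ⟨
      inv k * 1#                                                 ≈⟨ *-congˡ (inverse (suc k) k<K) ⟨
      inv k * (poch p p k * (1# - p * p ^ k) * inv (suc k))
        ≈⟨ solve 4 (λ i P F j → i :* (P :* F :* j) := P :* i :* (F :* j)) refl (inv k) (poch p p k) (1# - p * p ^ k) (inv (suc k)) ⟩
      poch p p k * inv k * ((1# - p * p ^ k) * inv (suc k))      ≈⟨ *-congʳ (inverse k (ℕ.<⇒≤ k<K)) ⟩
      1# * ((1# - p * p ^ k) * inv (suc k))                      ≈⟨ *-identityˡ _ ⟩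
      (1# - p * p ^ k) * inv (suc k)                             ∎

    -- A parameter `p ^ (m + 1)` over the denominator `(p; p)_k` is thus a polynomial of degree `m`
    -- in `p ^ k`; this is what brings the sum into Karlsson-Minton form.
    poch-inv : ∀ m k → m ℕ.≤ K → k ℕ.≤ K →
               poch (p * p ^ m) p k * inv k ≈ inv m * eval (powers p m) (p ^ k)
    poch-inv m k m≤K k≤K = begin
      U * inv k                             ≈⟨ *-identityˡ _ ⟨
      1# * (U * inv k)                      ≈⟨ *-congʳ (inverse m m≤K) ⟨
      poch p p m * inv m * (U * inv k)      ≈⟨ solve 4 (λ P i U j → P :* i :* (U :* j) := i :* j :* (P :* U)) refl (poch p p m) (inv m) U (inv k) ⟩
      inv m * inv k * (poch p p m * U)      ≈⟨ *-congˡ (poch-swap p m k) ⟩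
      inv m * inv k * (poch p p k * V)      ≈⟨ solve 4 (λ i j P V → i :* j :* (P :* V) := P :* j :* (i :* V)) refl (inv m) (inv k) (poch p p k) V ⟩
      poch p p k * inv k * (inv m * V)      ≈⟨ *-congʳ (inverse k k≤K) ⟩
      1# * (inv m * V)                      ≈⟨ *-identityˡ _ ⟩
      inv m * V                             ≈⟨ *-congˡ (eval-powers p m (p ^ k)) ⟨
      inv m * eval (powers p m) (p ^ k)     ∎
      where
      U = poch (p * p ^ m) p k
      V = poch (p * p ^ k) p m

    term : Carrier → List Carrier → ℕ → Carrier
    term y cs k = poch y p k * inv k * p ^ k * eval cs (p ^ k)

    -- The induction step is (1 - p^(k+1)) + (1 - y) p^(k+1) = 1 - y p^(k+1).
    telescope : ∀ y k → k ℕ.≤ K → sum (suc k) (term y []) ≈ poch (y * p) p k * inv k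
    telescope y zero _ = solve 1 (λ i → :0 :+ :1 :* i :* :1 :* :1 := :1 :* i) refl (inv 0)
    telescope y (suc k) k<K = begin
      sum (suc k) (term y []) + poch y p (suc k) * inv (suc k) * p ^ suc k * 1#
        ≈⟨ +-cong (trans (telescope y k (ℕ.<⇒≤ k<K)) (*-congˡ (inv-suc k k<K)))
                  (*-congʳ (*-congʳ (*-congʳ (poch-suc y p k)))) ⟩
      V * ((1# - p * B) * I) + (1# - y) * V * I * (p * B) * 1#
        ≈⟨ solve 5 (λ V p B I y → V :* ((:1 :- p :* B) :* I) :+ (:1 :- y) :* V :* I :* (p :* B) :* :1
                     := V :* (:1 :- y :* p :* B) :* I) refl V p B I y ⟩
      V * (1# - y * p * B) * I  ∎
      where
      V = poch (y * p) p k
      B = p ^ k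
      I = inv (suc k)

    -- As y p^M = 1, the factor 1 - c X is (1 - c p^M) + c p^M (1 - y X). At X = p^k the factor 1 -
    -- y X extends (y; p)_k to (y; p)_(k+1) = (1 - y)(y p; p)_k, so a linear factor is removed at
    -- the price of a second sum with y p for y.
    term-∷ : ∀ y M c cs → y * p ^ M ≈ 1# → ∀ k →
      term y (c ∷ cs) k ≈ (1# - c * p ^ M) * term y cs k + c * p ^ M * (1# - y) * term (y * p) cs k
    term-∷ y M c cs yB≈1 k = begin
      P * I * X * ((1# - c * X) * E)
        ≈⟨ *-congˡ (*-congʳ (+-congˡ (-‿cong (*-congʳ (trans (sym (*-identityʳ c)) (*-congˡ (sym yB≈1))))))) ⟩
      P * I * X * ((1# - c * (y * B) * X) * E)
        ≈⟨ solve 7 (λ P I X c y B E → P :* I :* X :* ((:1 :- c :* (y :* B) :* X) :* E)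
             := (:1 :- c :* B) :* (P :* I :* X :* E) :+ c :* B :* (P :* (:1 :- y :* X)) :* (I :* X :* E))
             refl P I X c y B E ⟩
      (1# - c * B) * (P * I * X * E) + c * B * poch y p (suc k) * (I * X * E)
        ≈⟨ +-congˡ (*-congʳ (*-congˡ (poch-suc y p k))) ⟩
      (1# - c * B) * (P * I * X * E) + c * B * ((1# - y) * Q) * (I * X * E)
        ≈⟨ +-congˡ (solve 6 (λ F G Q I X E → F :* (G :* Q) :* (I :* X :* E) := F :* G :* (Q :* I :* X :* E)) refl (c * B) (1# - y) Q I X E) ⟩
      (1# - c * B) * (P * I * X * E) + c * B * (1# - y) * (Q * I * X * E) ∎
      where
      P = poch y p k
      Q = poch (y * p) p k
      I = inv k
      X = p ^ k
      B = p ^ M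
      E = eval cs X

    sum-∷ : ∀ y M c cs → y * p ^ M ≈ 1# → ∀ N →
      sum N (term y (c ∷ cs)) ≈ (1# - c * p ^ M) * sum N (term y cs) + c * p ^ M * (1# - y) * sum N (term (y * p) cs)
    sum-∷ y M c cs yB≈1 N = trans (sum-cong N (λ k _ → term-∷ y M c cs yB≈1 k)) (sum-linear N _ _ _ _)

    -- Both sums in `sum-∷` again have degree below their bound: one keeps `M`, the other lowers it
    -- together with the length. For the empty list the telescoped value (y p; p)_K contains the
    -- factor 1 - y p^M.
    sum-vanishes : ∀ cs M y → y * p ^ M ≈ 1# → length cs ℕ.< M → M ℕ.≤ K →
                   sum (suc K) (term y cs) ≈ 0#
    sum-vanishes [] (suc M) y yB≈1 _ M<K = begin
      sum (suc K) (term y [])        ≈⟨ telescope y K ℕ.≤-refl ⟩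
      poch (y * p) p K * inv K       ≈⟨ *-congʳ (poch-root (y * p) p (trans (*-assoc _ _ _) yB≈1) M<K) ⟩
      0# * inv K                     ≈⟨ zeroˡ _ ⟩
      0#                             ∎
    sum-vanishes (c ∷ cs) (suc M) y yB≈1 (s≤s l<M) M<K = begin
      sum (suc K) (term y (c ∷ cs))  ≈⟨ sum-∷ y (suc M) c cs yB≈1 (suc K) ⟩
      _ + _                          ≈⟨ +-cong (*-congˡ (sum-vanishes cs (suc M) y yB≈1 (ℕ.m<n⇒m<1+n l<M) M<K))
                                               (*-congˡ (sum-vanishes cs M (y * p) (trans (*-assoc _ _ _) yB≈1) l<M (ℕ.<⇒≤ M<K))) ⟩
      _ * 0# + _ * 0#                ≈⟨ +-cong (zeroʳ _) (zeroʳ _) ⟩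
      0# + 0#                        ≈⟨ +-identityʳ 0# ⟩
      0#                             ∎

    -- The sum that keeps `y` has too small a degree and vanishes. The other one is multiplied by c
    -- p^M (1 - y) = -c (1 - p^M), which supplies one more factor of `lead` and one of `(p; p)_M`.
    sum-lead : ∀ cs M y → y * p ^ M ≈ 1# → length cs ≡ M → M ℕ.≤ K →
               sum (suc K) (term y cs) ≈ poch p p M * lead cs
    sum-lead [] zero y y1≈1 _ _ = begin
      sum (suc K) (term y [])        ≈⟨ telescope y K ℕ.≤-refl ⟩
      poch (y * p) p K * inv K       ≈⟨ *-congʳ (poch-cong p K (trans (*-congʳ (trans (sym (*-identityʳ y)) y1≈1)) (*-identityˡ p))) ⟩
      poch p p K * inv K             ≈⟨ inverse K ℕ.≤-refl ⟩
      1#                             ≈⟨ *-identityʳ 1# ⟨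
      1# * 1#                        ∎
    sum-lead (c ∷ cs) (suc M) y yB≈1 l≡M M<K = begin
      sum (suc K) (term y (c ∷ cs))  ≈⟨ sum-∷ y (suc M) c cs yB≈1 (suc K) ⟩
      _ + _                          ≈⟨ +-cong (*-congˡ (sum-vanishes cs (suc M) y yB≈1 (ℕ.≤-reflexive l≡M) M<K))
                                               (*-congˡ (sum-lead cs M (y * p) (trans (*-assoc _ _ _) yB≈1) (ℕ.suc-injective l≡M) (ℕ.<⇒≤ M<K))) ⟩
      (1# - c * B) * 0# + c * B * (1# - y) * (P * L)
        ≈⟨ solve 5 (λ c B y P L → (:1 :- c :* B) :* :0 :+ c :* B :* (:1 :- y) :* (P :* L) := c :* P :* L :* (B :- y :* B)) refl c B y P L ⟩
      c * P * L * (B - y * B)        ≈⟨ *-congˡ (+-congˡ (-‿cong yB≈1)) ⟩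
      c * P * L * (B - 1#)           ≈⟨ solve 4 (λ c P L B → c :* P :* L :* (B :- :1) := P :* (:1 :- B) :* (:- c :* L)) refl c P L B ⟩
      P * (1# - B) * (- c * L)       ∎
      where
      B = p ^ suc M
      P = poch p p M
      L = lead cs

-- First-order expansions

module FirstOrder {c ℓ} (R : CommutativeRing c ℓ) where
  open CommutativeRing R
  open import Algebra.Properties.Semiring.Exp semiring using (_^_)
  open import Algebra.Properties.Semiring.Mult semiring using () renaming (_×_ to _·_)
  open ℤ-Solver R
  open Pochhammer R
  open import Relation.Binary.Reasoning.Setoid setoid

  module SquareZero (ε : Carrier) (ε²≈0 : ε * ε ≈ 0#) where

    infix 4 _≈_+ε_
    _≈_+ε_ : Carrier → Carrier → Carrier → Set ℓ
    x ≈ a +ε b = x ≈ a + ε * b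

    constant : ∀ {x a} → x ≈ a → x ≈ a +ε 0#
    constant {a = a} x≈a = trans x≈a (solve 2 (λ a e → a := a :+ e :* :0) refl a ε)

    infixl 6 _⊕_
    infixl 7 _⊗_

    _⊕_ : ∀ {x y a b a′ b′} → x ≈ a +ε a′ → y ≈ b +ε b′ → x + y ≈ a + b +ε a′ + b′
    _⊕_ {a = a} {b} {a′} {b′} x≈ y≈ = trans (+-cong x≈ y≈)
      (solve 5 (λ a a′ b b′ e → (a :+ e :* a′) :+ (b :+ e :* b′) := (a :+ b) :+ e :* (a′ :+ b′)) refl a a′ b b′ ε)

    _⊗_ : ∀ {x y a b a′ b′} → x ≈ a +ε a′ → y ≈ b +ε b′ → x * y ≈ a * b +ε a * b′ + a′ * b
    _⊗_ {x} {y} {a} {b} {a′} {b′} x≈ y≈ = begin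
      x * y                                              ≈⟨ *-cong x≈ y≈ ⟩
      (a + ε * a′) * (b + ε * b′)
        ≈⟨ solve 5 (λ a a′ b b′ e → (a :+ e :* a′) :* (b :+ e :* b′) := a :* b :+ e :* (a :* b′ :+ a′ :* b) :+ e :* e :* (a′ :* b′)) refl a a′ b b′ ε ⟩
      a * b + ε * (a * b′ + a′ * b) + ε * ε * (a′ * b′)  ≈⟨ +-congˡ (trans (*-congʳ ε²≈0) (zeroˡ _)) ⟩
      a * b + ε * (a * b′ + a′ * b) + 0#                 ≈⟨ +-identityʳ _ ⟩
      a * b + ε * (a * b′ + a′ * b)                      ∎

    +ε-cong : ∀ {x a a′ b b′} → a ≈ b → a′ ≈ b′ → x ≈ a +ε a′ → x ≈ b +ε b′
    +ε-cong a≈b a′≈b′ x≈ = trans x≈ (+-cong a≈b (*-congˡ a′≈b′))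

    +ε-0 : ∀ {x a a′} → a′ ≈ 0# → x ≈ a +ε a′ → x ≈ a
    +ε-0 a′≈0 x≈ = trans x≈ (trans (+-congˡ (trans (*-congˡ a′≈0) (zeroʳ ε))) (+-identityʳ _))

    pow-1+ε : ∀ {x a} → x ≈ 1# +ε a → ∀ k → x ^ k ≈ 1# +ε (k · 1#) * a
    pow-1+ε {a = a} x≈ zero = +ε-cong refl (sym (zeroˡ a)) (constant refl)
    pow-1+ε {a = a} x≈ (suc k) = +ε-cong (*-identityˡ 1#)
      (solve 2 (λ t a → :1 :* (t :* a) :+ a :* :1 := (:1 :+ t) :* a) refl (k · 1#) a)
      (x≈ ⊗ pow-1+ε x≈ k)

    -- The power rule, multiplied through by a to avoid the exponent k − 1.
    pow-+ε : ∀ {x a a′} → x ≈ a +ε a′ → ∀ k →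
             ∃ λ b → (x ^ k ≈ a ^ k +ε b) × (a * b ≈ (k · 1#) * (a ^ k * a′))
    pow-+ε {a = a} x≈ zero = 0# , constant refl , trans (zeroʳ a) (sym (zeroˡ _))
    pow-+ε {a = a} {a′} x≈ (suc k) with pow-+ε x≈ k
    ... | b , xᵏ≈ , ab≈ = a * b + a′ * a ^ k , x≈ ⊗ xᵏ≈ , (begin
      a * (a * b + a′ * a ^ k)                        ≈⟨ *-congˡ (+-congʳ ab≈) ⟩
      a * ((k · 1#) * (a ^ k * a′) + a′ * a ^ k)
        ≈⟨ solve 4 (λ a t P a′ → a :* (t :* (P :* a′) :+ a′ :* P) := (:1 :+ t) :* (a :* P :* a′)) refl a (k · 1#) (a ^ k) a′ ⟩
      (1# + k · 1#) * (a * a ^ k * a′)                ∎)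

    -- The Euler derivative x ∂/∂x of `poch x p k`, by the product rule; it is the right derivative
    -- for the scaling of `x` by 1 + t ε.
    poch′ : Carrier → Carrier → ℕ → Carrier
    poch′ x p zero = 0#
    poch′ x p (suc k) = poch′ x p k * (1# - x * p ^ k) - poch x p k * (x * p ^ k)

    poch-+ε : ∀ {x y t} p → y ≈ x +ε t * x → ∀ k → poch y p k ≈ poch x p k +ε t * poch′ x p k
    poch-+ε {t = t} p y≈ zero = +ε-cong refl (sym (zeroʳ t)) (constant refl)
    poch-+ε {x} {y} {t} p y≈ (suc k) = +ε-cong refl
      (solve 5 (λ P P′ x B t → P :* :- (t :* (x :* B)) :+ t :* P′ :* (:1 :- x :* B)
                  := t :* (P′ :* (:1 :- x :* B) :- P :* (x :* B))) refl (poch x p k) (poch′ x p k) x (p ^ k) t)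
      (poch-+ε p y≈ k ⊗ factor)
      where
      factor : 1# - y * p ^ k ≈ 1# - x * p ^ k +ε - (t * (x * p ^ k))
      factor = trans (+-congˡ (-‿cong (*-congʳ y≈)))
        (solve 4 (λ x B t e → :1 :- (x :+ e :* (t :* x)) :* B := :1 :- x :* B :+ e :* :- (t :* (x :* B))) refl x (p ^ k) t ε)

    -- The weights 2 and e + 1 make the first-order terms in a′ and in b′ cancel simultaneously.
    combine : ∀ e {X Y x y a a′ b b′} (let t = e · 1#; s = 1# + (1# + t)) →
      X ≈ a +ε a′ → Y ≈ a +ε - s * a′ → x ≈ b +ε b′ → y ≈ b +ε - s * b′ →
      X ^ e * x * ((1# + 1#) * (X * y) + (1# + t) * (Y * x)) ≈ (1# + s) * (a ^ suc e * b ^ 2)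
    combine e {X} {Y} {x} {y} {a} {a′} {b} {b′} X≈ Y≈ x≈ y≈ with pow-+ε X≈ e
    ... | Z , Xᵉ≈ , aZ≈ = trans
      (+ε-0 ε-part≈0 (Xᵉ≈ ⊗ x≈ ⊗ (constant refl ⊗ (X≈ ⊗ y≈) ⊕ constant refl ⊗ (Y≈ ⊗ x≈))))
      (solve 4 (λ a P b t → P :* b :* ((:1 :+ :1) :* (a :* b) :+ (:1 :+ t) :* (a :* b))
                  := (:1 :+ (:1 :+ (:1 :+ t))) :* (a :* P :* (b :* (b :* :1)))) refl a (a ^ e) b t)
      where
      t = e · 1#
      s = 1# + (1# + t)
      P = a ^ e
      -- The left side is the coefficient of ε exactly as `_⊗_` and `_⊕_` produce it. It is a
      -- multiple of `a * Z - t * (P * a′)`, which is zero by the power rule.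
      ε-part≈0 : P * b * ((1# + 1#) * (a * (- s * b′) + a′ * b) + 0# * (a * b) + ((1# + t) * (a * b′ + - s * a′ * b) + 0# * (a * b)))
                 + (P * b′ + Z * b) * ((1# + 1#) * (a * b) + (1# + t) * (a * b)) ≈ 0#
      ε-part≈0 = begin
        _  ≈⟨ solve 7 (λ P a a′ b b′ Z t → let s = :1 :+ (:1 :+ t); o = :0 in
                 P :* b :* ((:1 :+ :1) :* (a :* (:- s :* b′) :+ a′ :* b) :+ o :* (a :* b) :+ ((:1 :+ t) :* (a :* b′ :+ :- s :* a′ :* b) :+ o :* (a :* b)))
                 :+ (P :* b′ :+ Z :* b) :* ((:1 :+ :1) :* (a :* b) :+ (:1 :+ t) :* (a :* b))
                 := (a :* Z :- t :* (P :* a′)) :* ((:1 :+ s) :* (b :* b))) refl P a a′ b b′ Z t ⟩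
        (a * Z - t * (P * a′)) * ((1# + s) * (b * b))  ≈⟨ *-congʳ (+-congʳ aZ≈) ⟩
        (t * (P * a′) - t * (P * a′)) * ((1# + s) * (b * b))  ≈⟨ *-congʳ (-‿inverseʳ _) ⟩
        0# * ((1# + s) * (b * b))                      ≈⟨ zeroˡ _ ⟩
        0#                                             ∎

-- For d = e + 3, m = m′ + 1 and n = d m − 1 these are n − 1 − m and n − 1.
degree lastIndex : ℕ → ℕ → ℕ
degree e m′ = e ℕ.* suc m′ ℕ.+ (m′ ℕ.+ m′)
lastIndex e m′ = suc (degree e m′ ℕ.+ m′)

-- Evaluation of the sum in a ring with q^n = 1 + ε and ε² = 0

module Evaluation {c ℓ} (R : CommutativeRing c ℓ) where
  open CommutativeRing R
  open Exp semiring
  open Mult semiring using () renaming (_×_ to _·_)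
  open CommutativeExp commutativeSemiring using (^-distrib-*)
  open ℤ-Solver R
  open Sums R
  open Pochhammer R
  open FirstOrder R
  open import Relation.Binary.Reasoning.Setoid setoid

  -- The base is p = q ^ d with d = e + 3, and m = m′ + 1.
  module AtOrder (q ε : Carrier) (ε²≈0 : ε * ε ≈ 0#) (e m′ : ℕ)
    (qⁿ≈1+ε : q ^ suc (lastIndex e m′) ≈ 1# + ε) (inv : ℕ → Carrier)
    (inverse : ∀ k → k ℕ.≤ lastIndex e m′ → poch (q ^ (3 ℕ.+ e)) (q ^ (3 ℕ.+ e)) k * inv k ≈ 1#) where

    private
      m M′ K : ℕ
      m = suc m′
      M′ = degree e m′
      K = lastIndex e m′

      p : Carrier
      p = q ^ (3 ℕ.+ e)

    open SquareZero ε ε²≈0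
    open KarlssonMinton p K inv inverse

    private
      -- In terms of d these are d - 3 and d - 1; so `1# + t` is d - 2, `1# + s` is d, and `- s` is
      -- the exceptional weight.
      t s : Carrier
      t = e · 1#
      s = 1# + (1# + t)

      M : ℕ
      M = suc M′

      -- `x` and `X` are q and q p scaled by 1 + ε, while `y` and `Y` are the same scaled by 1 - (d
      -- - 1) ε. The first two are powers of p as they stand; `y` is given by its expansion and
      -- shown afterwards to be inverse to a power of p.
      x X y Y : Carrier
      x = p ^ m
      X = p * p ^ m
      y = q + ε * (- s * q)
      Y = y * p

      L L′ : Carrier
      L = lead (powers p m)
      L′ = lead (powers p m′)

    qⁿ≈ : q ^ suc K ≈ 1# +ε 1#
    qⁿ≈ = trans qⁿ≈1+ε (+-congˡ (sym (*-identityʳ ε)))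

    -- As d m = n + 1, `p ^ m` is q · q^n.
    x≈ : x ≈ q +ε 1# * q
    x≈ = begin
      p ^ m                      ≈⟨ ^-assocʳ q (3 ℕ.+ e) m ⟩
      q ^ ((3 ℕ.+ e) ℕ.* m)      ≡⟨ ≡.cong (q ^_) (arith e m′) ⟩
      q * q ^ suc K              ≈⟨ *-congˡ qⁿ≈1+ε ⟩
      q * (1# + ε)               ≈⟨ solve 2 (λ q e → q :* (:1 :+ e) := q :+ e :* (:1 :* q)) refl q ε ⟩
      q + ε * (1# * q)           ∎
      where
      arith : ∀ e m′ → (3 ℕ.+ e) ℕ.* suc m′ ≡ suc (suc (suc (e ℕ.* suc m′ ℕ.+ (m′ ℕ.+ m′) ℕ.+ m′)))
      arith = ℕ-solve-∀

    -- As M = n - m, d M + 1 = d n - (n + 1) + 1 = (d - 1) n.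
    pᴹq≈ : p ^ M * q ≈ 1# +ε s
    pᴹq≈ = +ε-cong refl (*-identityʳ s) (trans (begin
      p ^ M * q                          ≈⟨ *-comm _ _ ⟩
      q * p ^ M                          ≈⟨ *-congˡ (^-assocʳ q (3 ℕ.+ e) M) ⟩
      q ^ suc ((3 ℕ.+ e) ℕ.* M)          ≡⟨ ≡.cong (q ^_) (arith e m′) ⟩
      q ^ (suc K ℕ.* (2 ℕ.+ e))          ≈⟨ ^-assocʳ q (suc K) (2 ℕ.+ e) ⟨
      (q ^ suc K) ^ (2 ℕ.+ e)            ∎) (pow-1+ε qⁿ≈ (2 ℕ.+ e)))
      where
      arith : ∀ e m′ → let M′ = e ℕ.* suc m′ ℕ.+ (m′ ℕ.+ m′) in
              suc ((3 ℕ.+ e) ℕ.* suc M′) ≡ suc (suc (M′ ℕ.+ m′)) ℕ.* (2 ℕ.+ e)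
      arith = ℕ-solve-∀

    ypᴹ≈1 : y * p ^ M ≈ 1#
    ypᴹ≈1 = begin
      (q + ε * (- s * q)) * p ^ M     ≈⟨ solve 4 (λ q e s B → (q :+ e :* (:- s :* q)) :* B := (:1 :+ e :* :- s) :* (B :* q)) refl q ε s (p ^ M) ⟩
      (1# + ε * - s) * (p ^ M * q)    ≈⟨ +ε-0 (solve 1 (λ s → :1 :* s :+ :- s :* :1 := :0) refl s) (refl ⊗ pᴹq≈) ⟩
      1# * 1#                         ≈⟨ *-identityˡ 1# ⟩
      1#                              ∎

    Ypᴹ′≈1 : Y * p ^ M′ ≈ 1#
    Ypᴹ′≈1 = trans (*-assoc _ _ _) ypᴹ≈1

    X≈ : X ≈ q * p +ε 1# * (q * p)
    X≈ = trans (*-congˡ x≈) (solve 3 (λ q p e → p :* (q :+ e :* (:1 :* q)) := q :* p :+ e :* (:1 :* (q :* p))) refl q p ε)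

    Y≈ : Y ≈ q * p +ε - s * (q * p)
    Y≈ = solve 4 (λ q p e s → (q :+ e :* (:- s :* q)) :* p := q :* p :+ e :* (:- s :* (q :* p))) refl q p ε s

    -- The parameters of weight 1 that remain when the exceptional weight sits on q (`cs₁`: d - 2
    -- times `X`, once `x`) or on q p (`cs₂`: d - 3 times `X`, twice `x`). By `poch-inv`, `X`
    -- contributes degree `m` and `x` degree `m′`; the totals are the exponents that invert `y` and
    -- `Y`.
    cs₁ cs₂ : List Carrier
    cs₁ = copies (suc e) (powers p m) ++ powers p m′
    cs₂ = copies e (powers p m) ++ (powers p m′ ++ powers p m′)

    length-copies-powers : ∀ k → length (copies k (powers p m)) ≡ k ℕ.* m
    length-copies-powers k = ≡.trans (length-copies k (powers p m)) (≡.cong (k ℕ.*_) (length-powers p m))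

    length-cs₁ : length cs₁ ≡ M
    length-cs₁ = ≡.trans (length-++ (copies (suc e) (powers p m)))
      (≡.trans (≡.cong₂ ℕ._+_ (length-copies-powers (suc e)) (length-powers p m′)) (arith e m′))
      where
      arith : ∀ e m′ → suc e ℕ.* suc m′ ℕ.+ m′ ≡ suc (e ℕ.* suc m′ ℕ.+ (m′ ℕ.+ m′))
      arith = ℕ-solve-∀

    length-cs₂ : length cs₂ ≡ M′
    length-cs₂ = ≡.trans (length-++ (copies e (powers p m)))
      (≡.cong₂ ℕ._+_ (length-copies-powers e)
        (≡.trans (length-++ (powers p m′)) (≡.cong₂ ℕ._+_ (length-powers p m′) (length-powers p m′))))

    lead-cs₁ : lead cs₁ ≈ L ^ suc e * L′
    lead-cs₁ = trans (lead-++ (copies (suc e) (powers p m)) _) (*-congʳ (lead-copies (suc e) (powers p m)))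

    lead-cs₂ : lead cs₂ ≈ L ^ e * (L′ * L′)
    lead-cs₂ = trans (lead-++ (copies e (powers p m)) _)
      (*-cong (lead-copies e (powers p m)) (lead-++ (powers p m′) (powers p m′)))

    eval-cs₁ : ∀ Z → eval cs₁ Z ≈ eval (powers p m) Z ^ suc e * eval (powers p m′) Z
    eval-cs₁ Z = trans (eval-++ (copies (suc e) (powers p m)) _ Z) (*-congʳ (eval-copies (suc e) (powers p m) Z))

    eval-cs₂ : ∀ Z → eval cs₂ Z ≈ eval (powers p m) Z ^ e * (eval (powers p m′) Z * eval (powers p m′) Z)
    eval-cs₂ Z = trans (eval-++ (copies e (powers p m)) _ Z)
      (*-cong (eval-copies e (powers p m) Z) (eval-++ (powers p m′) (powers p m′) Z))

    c₁ c₂ : Carrier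
    c₁ = (1# + 1#) * (inv m ^ suc e * inv m′)
    c₂ = (1# + t) * (inv m ^ e * (inv m′ * inv m′))

    summand : ℕ → Carrier
    summand k = poch (q * p) p k ^ suc e * poch q p k ^ 2 * p ^ k * inv k ^ (3 ℕ.+ e)

    m≤K : m ℕ.≤ K
    m≤K = s≤s (ℕ.m≤n+m m′ M′)

    -- After `combine`, each of the d factors `inv k` is paired with one Pochhammer symbol. The pair
    -- with `y` or `Y` stays as the head of a Karlsson-Minton term, and `poch-inv` turns the others
    -- into polynomials.
    summand-split : ∀ k → k ℕ.≤ K → (1# + s) * summand k ≈ c₁ * term y cs₁ k + c₂ * term Y cs₂ k
    summand-split k k≤K = begin
      (1# + s) * (poch (q * p) p k ^ suc e * poch q p k ^ 2 * B * (i * (i * (i * iᵉ))))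
        ≈⟨ solve 6 (λ d a b B i j → d :* (a :* b :* B :* (i :* (i :* (i :* j)))) := d :* (a :* b) :* (B :* (i :* (i :* (i :* j)))))
             refl (1# + s) (poch (q * p) p k ^ suc e) (poch q p k ^ 2) B i iᵉ ⟩
      (1# + s) * (poch (q * p) p k ^ suc e * poch q p k ^ 2) * (B * (i * (i * (i * iᵉ))))
        ≈⟨ *-congʳ (combine e (+ε-cong refl (*-identityˡ _) (poch-+ε p X≈ k)) (poch-+ε p Y≈ k)
                              (+ε-cong refl (*-identityˡ _) (poch-+ε p x≈ k)) (poch-+ε p refl k)) ⟨
      PX ^ e * Px * ((1# + 1#) * (PX * Py) + (1# + t) * (PY * Px)) * (B * (i * (i * (i * iᵉ))))
        ≈⟨ solve 9 (λ F X x Y y t B i j →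
             F :* x :* ((:1 :+ :1) :* (X :* y) :+ (:1 :+ t) :* (Y :* x)) :* (B :* (i :* (i :* (i :* j))))
             := F :* j :* (x :* i) :* ((:1 :+ :1) :* (X :* i :* (y :* i)) :+ (:1 :+ t) :* (Y :* i :* (x :* i))) :* B)
             refl (PX ^ e) PX Px PY Py t B i iᵉ ⟩
      PX ^ e * iᵉ * (Px * i) * ((1# + 1#) * (PX * i * (Py * i)) + (1# + t) * (PY * i * (Px * i))) * B
        ≈⟨ *-congʳ (*-cong (*-cong PXᵉ Px≈) (+-cong (*-congˡ (*-congʳ PX≈)) (*-congˡ (*-congˡ Px≈)))) ⟩
      Iᵉ * Gᵉ * (I′ * G′) * ((1# + 1#) * (I * G * (Py * i)) + (1# + t) * (PY * i * (I′ * G′))) * B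
        ≈⟨ solve 11 (λ J H I′ G′ I G y Y i t B →
             J :* H :* (I′ :* G′) :* ((:1 :+ :1) :* (I :* G :* (y :* i)) :+ (:1 :+ t) :* (Y :* i :* (I′ :* G′))) :* B
             := (:1 :+ :1) :* (I :* J :* I′) :* (y :* i :* B :* (G :* H :* G′)) :+ (:1 :+ t) :* (J :* (I′ :* I′)) :* (Y :* i :* B :* (H :* (G′ :* G′))))
             refl Iᵉ Gᵉ I′ G′ I G Py PY i t B ⟩
      c₁ * (Py * i * B * (G * Gᵉ * G′)) + c₂ * (PY * i * B * (Gᵉ * (G′ * G′)))
        ≈⟨ +-cong (*-congˡ (*-congˡ (eval-cs₁ B))) (*-congˡ (*-congˡ (eval-cs₂ B))) ⟨
      c₁ * term y cs₁ k + c₂ * term Y cs₂ k ∎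
      where
      B = p ^ k
      i = inv k
      iᵉ = i ^ e
      PX = poch X p k
      PY = poch Y p k
      Px = poch x p k
      Py = poch y p k
      I = inv m
      Iᵉ = I ^ e
      I′ = inv m′
      G = eval (powers p m) B
      Gᵉ = G ^ e
      G′ = eval (powers p m′) B
      PX≈ : PX * i ≈ I * G
      PX≈ = poch-inv m k m≤K k≤K
      Px≈ : Px * i ≈ I′ * G′
      Px≈ = poch-inv m′ k (ℕ.<⇒≤ m≤K) k≤K
      PXᵉ : PX ^ e * iᵉ ≈ Iᵉ * Gᵉ
      PXᵉ = begin
        PX ^ e * i ^ e   ≈⟨ ^-distrib-* PX i e ⟨
        (PX * i) ^ e     ≈⟨ ^-congˡ e PX≈ ⟩
        (I * G) ^ e      ≈⟨ ^-distrib-* I G e ⟩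
        Iᵉ * Gᵉ          ∎

    sum-split : (1# + s) * sum (suc K) summand ≈
      c₁ * (poch p p M * (L ^ suc e * L′)) + c₂ * (poch p p M′ * (L ^ e * (L′ * L′)))
    sum-split = begin
      (1# + s) * sum (suc K) summand                                  ≈⟨ sum-*ˡ (suc K) _ _ ⟨
      sum (suc K) (λ k → (1# + s) * summand k)                        ≈⟨ sum-cong (suc K) (λ k k<1+K → summand-split k (ℕ.s≤s⁻¹ k<1+K)) ⟩
      sum (suc K) (λ k → c₁ * term y cs₁ k + c₂ * term Y cs₂ k)       ≈⟨ sum-linear (suc K) c₁ c₂ (term y cs₁) (term Y cs₂) ⟩
      c₁ * sum (suc K) (term y cs₁) + c₂ * sum (suc K) (term Y cs₂)
        ≈⟨ +-cong (*-congˡ (trans (sum-lead cs₁ M y ypᴹ≈1 length-cs₁ (s≤s (ℕ.m≤m+n M′ m′))) (*-congˡ lead-cs₁)))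
                  (*-congˡ (trans (sum-lead cs₂ M′ Y Ypᴹ′≈1 length-cs₂ (ℕ.m≤n⇒m≤1+n (ℕ.m≤m+n M′ m′))) (*-congˡ lead-cs₂))) ⟩
      c₁ * (poch p p M * (L ^ suc e * L′)) + c₂ * (poch p p M′ * (L ^ e * (L′ * L′))) ∎

    -- The inverse of `x`, obtained as `y` times the missing power of p. It allows `L′` to be
    -- expressed by `L`, since `L` is `- x * L′`.
    w : Carrier
    w = y * p ^ (e ℕ.* m ℕ.+ m′)

    wx≈1 : w * x ≈ 1#
    wx≈1 = begin
      y * p ^ (e ℕ.* m ℕ.+ m′) * p ^ m        ≈⟨ *-assoc _ _ _ ⟩
      y * (p ^ (e ℕ.* m ℕ.+ m′) * p ^ m)      ≈⟨ *-congˡ (^-homo-* p (e ℕ.* m ℕ.+ m′) m) ⟨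
      y * p ^ (e ℕ.* m ℕ.+ m′ ℕ.+ m)          ≡⟨ ≡.cong (λ j → y * p ^ j) (arith e m′) ⟩
      y * p ^ M                               ≈⟨ ypᴹ≈1 ⟩
      1#                                      ∎
      where
      arith : ∀ e m′ → e ℕ.* suc m′ ℕ.+ m′ ℕ.+ suc m′ ≡ suc (e ℕ.* suc m′ ℕ.+ (m′ ℕ.+ m′))
      arith = ℕ-solve-∀

    wq≈ : w * q ≈ 1# +ε - 1#
    wq≈ = begin
      w * q                      ≈⟨ *-congˡ (trans x[1-ε]≈q (*-identityʳ q)) ⟨
      w * (x * (1# + ε * - 1#))  ≈⟨ *-assoc _ _ _ ⟨
      w * x * (1# + ε * - 1#)    ≈⟨ *-congʳ wx≈1 ⟩
      1# * (1# + ε * - 1#)       ≈⟨ *-identityˡ _ ⟩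
      1# + ε * - 1#              ∎
      where
      x[1-ε]≈q : x * (1# + ε * - 1#) ≈ q * 1#
      x[1-ε]≈q = +ε-0 (solve 1 (λ q → q :* :- :1 :+ :1 :* q :* :1 := :0) refl q) (x≈ ⊗ refl)

    module _ (h E : ℕ) (2+e≡h+h : 2 ℕ.+ e ≡ h ℕ.+ h)
      (2+E≡ : 2 ℕ.+ E ≡ (3 ℕ.+ e) ℕ.* (m ℕ.* suc m ℕ.* h))
      (δ : Carrier) (δ[1+s]≈1 : δ * (1# + s) ≈ 1#) where

      -- Here the oddness of d enters: `h` is (d - 1)/2, so the power is one of `L * L`.
      L²⁺ᵉ≈ : L ^ (2 ℕ.+ e) ≈ q ^ (2 ℕ.+ E)
      L²⁺ᵉ≈ = begin
        L ^ (2 ℕ.+ e)                                ≡⟨ ≡.cong (L ^_) 2+e≡h+h ⟩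
        L ^ (h ℕ.+ h)                                ≈⟨ ^-homo-* L h h ⟩
        L ^ h * L ^ h                                ≈⟨ ^-distrib-* L L h ⟨
        (L * L) ^ h                                  ≈⟨ ^-congˡ h (lead-powers² p m) ⟩
        (p ^ (m ℕ.* suc m)) ^ h                      ≈⟨ ^-assocʳ p (m ℕ.* suc m) h ⟩
        p ^ (m ℕ.* suc m ℕ.* h)                      ≈⟨ ^-assocʳ q (3 ℕ.+ e) (m ℕ.* suc m ℕ.* h) ⟩
        q ^ ((3 ℕ.+ e) ℕ.* (m ℕ.* suc m ℕ.* h))      ≡⟨ ≡.cong (q ^_) 2+E≡ ⟨
        q ^ (2 ℕ.+ E)                                ∎

      -- With w q = 1 - ε and p^M q = 1 + (d - 1) ε, the first product contributes -2(d - 2)(q - 1)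
      -- ε and the second 2(d - 2)(q - 1) ε. The constant terms are 2 and d - 2 times (1 - q)².
      bracket : (1# + 1#) * ((q - w * q) * (q - p ^ M * q)) + (1# + t) * ((w * q - q) * (w * q - q)) ≈ (1# + s) * (1# - q) ^ 2
      bracket = trans
        (+ε-0 (solve 2 (λ q t → let s = :1 :+ (:1 :+ t); o = :0 in
                (:1 :+ :1) :* ((q :- :1) :* (o :- s) :+ (o :- :- :1) :* (q :- :1)) :+ o :* ((q :- :1) :* (q :- :1))
                :+ ((:1 :+ t) :* ((:1 :- q) :* (:- :1 :- o) :+ (:- :1 :- o) :* (:1 :- q)) :+ o :* ((:1 :- q) :* (:1 :- q))) := o) refl q t)
          (constant refl ⊗ ((constant refl ⊖ wq≈) ⊗ (constant refl ⊖ pᴹq≈))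
           ⊕ constant refl ⊗ ((wq≈ ⊖ constant refl) ⊗ (wq≈ ⊖ constant refl))))
        (solve 2 (λ q t → (:1 :+ :1) :* ((q :- :1) :* (q :- :1)) :+ (:1 :+ t) :* ((:1 :- q) :* (:1 :- q))
                  := (:1 :+ (:1 :+ (:1 :+ t))) :* ((:1 :- q) :* ((:1 :- q) :* :1))) refl q t)
        where
        infixl 6 _⊖_
        _⊖_ : ∀ {x y a b a′ b′} → x ≈ a +ε a′ → y ≈ b +ε b′ → x - y ≈ a - b +ε a′ - b′
        _⊖_ {a = a} {b} {a′} {b′} x≈ y≈ = trans (+-cong x≈ (-‿cong y≈))
          (solve 5 (λ a a′ b b′ e → (a :+ e :* a′) :- (b :+ e :* b′) := (a :- b) :+ e :* (a′ :- b′)) refl a a′ b b′ ε)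

      evaluation : sum (suc K) summand ≈ (1# - q) ^ 2 * poch p p M′ * q ^ E * inv m ^ (2 ℕ.+ e)
      evaluation = begin
        S                        ≈⟨ *-identityˡ S ⟨
        1# * S                   ≈⟨ *-congʳ δ[1+s]≈1 ⟨
        δ * (1# + s) * S         ≈⟨ *-assoc _ _ _ ⟩
        δ * ((1# + s) * S)       ≈⟨ *-congˡ (trans sum-split scaled) ⟩
        δ * ((1# + s) * T)       ≈⟨ *-assoc _ _ _ ⟨
        δ * (1# + s) * T         ≈⟨ *-congʳ δ[1+s]≈1 ⟩
        1# * T                   ≈⟨ *-identityˡ T ⟩
        T                        ∎
        where
        S = sum (suc K) summand
        P = poch p p M′
        I = inv m
        Iᵉ = I ^ e
        Lᵉ = L ^ e
        pᴹ = p ^ M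
        T = (1# - q) ^ 2 * P * q ^ E * I ^ (2 ℕ.+ e)
        I′≈ : inv m′ ≈ (1# - x) * I
        I′≈ = inv-suc m′ m≤K
        L′≈ : L′ ≈ - w * L
        L′≈ = begin
          L′               ≈⟨ *-identityˡ L′ ⟨
          1# * L′          ≈⟨ *-congʳ wx≈1 ⟨
          w * x * L′       ≈⟨ solve 3 (λ w x l → w :* x :* l := :- w :* (:- x :* l)) refl w x L′ ⟩
          - w * (- x * L′) ∎
        scaled : c₁ * (poch p p M * (L ^ suc e * L′)) + c₂ * (P * (L ^ e * (L′ * L′))) ≈ (1# + s) * T
        scaled = begin
          (1# + 1#) * (I ^ suc e * inv m′) * (P * (1# - pᴹ) * (L ^ suc e * L′)) + (1# + t) * (Iᵉ * (inv m′ * inv m′)) * (P * (Lᵉ * (L′ * L′)))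
            ≈⟨ +-cong (*-cong (*-congˡ (*-congˡ I′≈)) (*-congˡ (*-congˡ L′≈)))
                      (*-cong (*-congˡ (*-congˡ (*-cong I′≈ I′≈))) (*-congˡ (*-congˡ (*-cong L′≈ L′≈)))) ⟩
          (1# + 1#) * (I * Iᵉ * ((1# - x) * I)) * (P * (1# - pᴹ) * (L * Lᵉ * (- w * L)))
            + (1# + t) * (Iᵉ * ((1# - x) * I * ((1# - x) * I))) * (P * (Lᵉ * (- w * L * (- w * L))))
            ≈⟨ solve 9 (λ I J x P b L F w t →
                 (:1 :+ :1) :* (I :* J :* ((:1 :- x) :* I)) :* (P :* (:1 :- b) :* (L :* F :* (:- w :* L)))
                 :+ (:1 :+ t) :* (J :* ((:1 :- x) :* I :* ((:1 :- x) :* I))) :* (P :* (F :* (:- w :* L :* (:- w :* L))))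
                 := (P :* (I :* (I :* J))) :* ((:1 :+ :1) :* ((w :* x :- w) :* (:1 :- b)) :+ (:1 :+ t) :* ((w :- w :* x) :* (w :- w :* x))) :* (L :* (L :* F)))
                 refl I Iᵉ x P pᴹ L Lᵉ w t ⟩
          P * (I * (I * Iᵉ)) * ((1# + 1#) * ((w * x - w) * (1# - pᴹ)) + (1# + t) * ((w - w * x) * (w - w * x))) * (L * (L * Lᵉ))
            ≈⟨ *-cong (*-congˡ (+-cong (*-congˡ (*-congʳ (+-congʳ wx≈1))) (*-congˡ (*-cong (+-congˡ (-‿cong wx≈1)) (+-congˡ (-‿cong wx≈1)))))) L²⁺ᵉ≈ ⟩
          P * (I * (I * Iᵉ)) * ((1# + 1#) * ((1# - w) * (1# - pᴹ)) + (1# + t) * ((w - 1#) * (w - 1#))) * (q * (q * q ^ E))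
            -- Two of the factors q from the power of `L` are moved into the bracket, where only
            -- `w * q` and `pᴹ * q` have known expansions.
            ≈⟨ solve 7 (λ P J w b t q Q →
                 P :* J :* ((:1 :+ :1) :* ((:1 :- w) :* (:1 :- b)) :+ (:1 :+ t) :* ((w :- :1) :* (w :- :1))) :* (q :* (q :* Q))
                 := P :* J :* Q :* ((:1 :+ :1) :* ((q :- w :* q) :* (q :- b :* q)) :+ (:1 :+ t) :* ((w :* q :- q) :* (w :* q :- q))))
                 refl P (I * (I * Iᵉ)) w pᴹ t q (q ^ E) ⟩
          P * (I * (I * Iᵉ)) * q ^ E * ((1# + 1#) * ((q - w * q) * (q - pᴹ * q)) + (1# + t) * ((w * q - q) * (w * q - q)))
            ≈⟨ *-congˡ bracket ⟩
          P * (I * (I * Iᵉ)) * q ^ E * ((1# + s) * (1# - q) ^ 2)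
            ≈⟨ solve 5 (λ P J Q d r → P :* J :* Q :* (d :* r) := d :* (r :* P :* Q :* J)) refl P (I * (I * Iᵉ)) (q ^ E) (1# + s) ((1# - q) ^ 2) ⟩
          (1# + s) * T ∎

-- The ring ℚ[q]

infix 4 _≋_
-- A record because `p` and `r` cannot be inferred from the unfolded statement about coefficients.
record _≋_ (p r : Poly) : Set where
  constructor coefficientwise
  field at : p ≈ₚ r
open _≋_

coeff-+ : ∀ p r i → coeff (p +ₚ r) i ≡ coeff p i ℚ.+ coeff r i
coeff-+ [] r i = ≡.sym (ℚ.+-identityˡ _)
coeff-+ (a ∷ p) [] i = ≡.sym (ℚ.+-identityʳ _)
coeff-+ (a ∷ p) (b ∷ r) zero = ≡.refl
coeff-+ (a ∷ p) (b ∷ r) (suc i) = coeff-+ p r i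

coeff-map : ∀ f → f 0ℚ ≡ 0ℚ → ∀ p i → coeff (map f p) i ≡ f (coeff p i)
coeff-map f f0≡0 [] i = ≡.sym f0≡0
coeff-map f f0≡0 (a ∷ p) zero = ≡.refl
coeff-map f f0≡0 (a ∷ p) (suc i) = coeff-map f f0≡0 p i

coeff-scale : ∀ c p i → coeff (scaleₚ c p) i ≡ c ℚ.* coeff p i
coeff-scale c = coeff-map (c ℚ.*_) (ℚ.*-zeroʳ c)

coeff-neg : ∀ p i → coeff (-ₚ p) i ≡ ℚ.- coeff p i
coeff-neg = coeff-map ℚ.-_ ≡.refl

≋-refl : ∀ {p} → p ≋ p
≋-refl .at i = ≡.refl

≋-sym : ∀ {p r} → p ≋ r → r ≋ p
≋-sym p≋r .at i = ≡.sym (p≋r .at i)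

≋-trans : ∀ {p r s} → p ≋ r → r ≋ s → p ≋ s
≋-trans p≋r r≋s .at i = ≡.trans (p≋r .at i) (r≋s .at i)

+ₚ-cong : ∀ {p p′ r r′} → p ≋ p′ → r ≋ r′ → p +ₚ r ≋ p′ +ₚ r′
+ₚ-cong {p} {p′} {r} {r′} p≋ r≋ .at i = ≡.trans (coeff-+ p r i)
  (≡.trans (≡.cong₂ ℚ._+_ (p≋ .at i) (r≋ .at i)) (≡.sym (coeff-+ p′ r′ i)))

+ₚ-comm : ∀ p r → p +ₚ r ≋ r +ₚ p
+ₚ-comm p r .at i = ≡.trans (coeff-+ p r i) (≡.trans (ℚ.+-comm (coeff p i) (coeff r i)) (≡.sym (coeff-+ r p i)))

+ₚ-assoc : ∀ p r s → (p +ₚ r) +ₚ s ≋ p +ₚ (r +ₚ s)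
+ₚ-assoc p r s .at i = begin
  coeff ((p +ₚ r) +ₚ s) i                   ≡⟨ coeff-+ (p +ₚ r) s i ⟩
  coeff (p +ₚ r) i ℚ.+ coeff s i            ≡⟨ ≡.cong (ℚ._+ coeff s i) (coeff-+ p r i) ⟩
  (coeff p i ℚ.+ coeff r i) ℚ.+ coeff s i   ≡⟨ ℚ.+-assoc (coeff p i) (coeff r i) (coeff s i) ⟩
  coeff p i ℚ.+ (coeff r i ℚ.+ coeff s i)   ≡⟨ ≡.cong (coeff p i ℚ.+_) (coeff-+ r s i) ⟨
  coeff p i ℚ.+ coeff (r +ₚ s) i            ≡⟨ coeff-+ p (r +ₚ s) i ⟨
  coeff (p +ₚ (r +ₚ s)) i                   ∎
  where open ≡.≡-Reasoning

+ₚ-identityʳ : ∀ p → p +ₚ [] ≋ p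
+ₚ-identityʳ p = +ₚ-comm p []

-ₚ-cong : ∀ {p r} → p ≋ r → -ₚ p ≋ -ₚ r
-ₚ-cong {p} {r} p≋r .at i = ≡.trans (coeff-neg p i) (≡.trans (≡.cong ℚ.-_ (p≋r .at i)) (≡.sym (coeff-neg r i)))

-ₚ-inverseʳ : ∀ p → p -ₚ p ≋ []
-ₚ-inverseʳ p .at i = ≡.trans (coeff-+ p (-ₚ p) i)
  (≡.trans (≡.cong (coeff p i ℚ.+_) (coeff-neg p i)) (ℚ.+-inverseʳ (coeff p i)))

∷-cong : ∀ {a b p r} → a ≡ b → p ≋ r → a ∷ p ≋ b ∷ r
∷-cong a≡b p≋r .at zero = a≡b
∷-cong a≡b p≋r .at (suc i) = p≋r .at i

0∷[]≋[] : 0ℚ ∷ [] ≋ []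
0∷[]≋[] .at zero = ≡.refl
0∷[]≋[] .at (suc i) = ≡.refl

scale-cong : ∀ c {p r} → p ≋ r → scaleₚ c p ≋ scaleₚ c r
scale-cong c {p} {r} p≋r .at i =
  ≡.trans (coeff-scale c p i) (≡.trans (≡.cong (c ℚ.*_) (p≋r .at i)) (≡.sym (coeff-scale c r i)))

scale-+ₚ : ∀ c p r → scaleₚ c (p +ₚ r) ≋ scaleₚ c p +ₚ scaleₚ c r
scale-+ₚ c p r .at i = begin
  coeff (scaleₚ c (p +ₚ r)) i                     ≡⟨ coeff-scale c (p +ₚ r) i ⟩
  c ℚ.* coeff (p +ₚ r) i                          ≡⟨ ≡.cong (c ℚ.*_) (coeff-+ p r i) ⟩
  c ℚ.* (coeff p i ℚ.+ coeff r i)                 ≡⟨ ℚ.*-distribˡ-+ c (coeff p i) (coeff r i) ⟩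
  c ℚ.* coeff p i ℚ.+ c ℚ.* coeff r i             ≡⟨ ≡.cong₂ ℚ._+_ (coeff-scale c p i) (coeff-scale c r i) ⟨
  coeff (scaleₚ c p) i ℚ.+ coeff (scaleₚ c r) i   ≡⟨ coeff-+ (scaleₚ c p) (scaleₚ c r) i ⟨
  coeff (scaleₚ c p +ₚ scaleₚ c r) i              ∎
  where open ≡.≡-Reasoning

scale-scale : ∀ a b p → scaleₚ a (scaleₚ b p) ≋ scaleₚ (a ℚ.* b) p
scale-scale a b p .at i = begin
  coeff (scaleₚ a (scaleₚ b p)) i   ≡⟨ coeff-scale a (scaleₚ b p) i ⟩
  a ℚ.* coeff (scaleₚ b p) i        ≡⟨ ≡.cong (a ℚ.*_) (coeff-scale b p i) ⟩
  a ℚ.* (b ℚ.* coeff p i)           ≡⟨ ℚ.*-assoc a b (coeff p i) ⟨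
  (a ℚ.* b) ℚ.* coeff p i           ≡⟨ coeff-scale (a ℚ.* b) p i ⟨
  coeff (scaleₚ (a ℚ.* b) p) i      ∎
  where open ≡.≡-Reasoning

scale-1 : ∀ p → scaleₚ 1ℚ p ≋ p
scale-1 p .at i = ≡.trans (coeff-scale 1ℚ p i) (ℚ.*-identityˡ (coeff p i))

scale-0 : ∀ p → scaleₚ 0ℚ p ≋ []
scale-0 p .at i = ≡.trans (coeff-scale 0ℚ p i) (ℚ.*-zeroˡ (coeff p i))

+ₚ-interchange : ∀ p r s t → (p +ₚ r) +ₚ (s +ₚ t) ≋ (p +ₚ s) +ₚ (r +ₚ t)
+ₚ-interchange p r s t =
  ≋-trans (+ₚ-assoc p r _) (≋-trans (+ₚ-cong (≋-refl {p})
    (≋-trans (≋-sym (+ₚ-assoc r s t)) (≋-trans (+ₚ-cong (+ₚ-comm r s) (≋-refl {t})) (+ₚ-assoc s r t))))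
    (≋-sym (+ₚ-assoc p s _)))

*ₚ-congʳ : ∀ p {r s} → r ≋ s → p *ₚ r ≋ p *ₚ s
*ₚ-congʳ [] r≋s = ≋-refl
*ₚ-congʳ (a ∷ p) r≋s = +ₚ-cong (scale-cong a r≋s) (∷-cong ≡.refl (*ₚ-congʳ p r≋s))

*ₚ-zeroʳ : ∀ p → p *ₚ [] ≋ []
*ₚ-zeroʳ [] = ≋-refl
*ₚ-zeroʳ (a ∷ p) = ≋-trans (∷-cong ≡.refl (*ₚ-zeroʳ p)) 0∷[]≋[]

*ₚ-distribˡ : ∀ p r s → p *ₚ (r +ₚ s) ≋ p *ₚ r +ₚ p *ₚ s
*ₚ-distribˡ [] r s = ≋-refl
*ₚ-distribˡ (a ∷ p) r s =
  ≋-trans (+ₚ-cong (scale-+ₚ a r s) (∷-cong (≡.sym (ℚ.+-identityˡ 0ℚ)) (*ₚ-distribˡ p r s)))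
    (+ₚ-interchange (scaleₚ a r) (scaleₚ a s) (0ℚ ∷ p *ₚ r) (0ℚ ∷ p *ₚ s))

*ₚ-∷ʳ : ∀ p b r → p *ₚ (b ∷ r) ≋ scaleₚ b p +ₚ (0ℚ ∷ p *ₚ r)
*ₚ-∷ʳ [] b r = ≋-sym 0∷[]≋[]
*ₚ-∷ʳ (a ∷ p) b r = ∷-cong (≡.cong (ℚ._+ 0ℚ) (ℚ.*-comm a b))
  (≋-trans (+ₚ-cong (≋-refl {scaleₚ a r}) (*ₚ-∷ʳ p b r))
  (≋-trans (≋-sym (+ₚ-assoc (scaleₚ a r) (scaleₚ b p) _))
  (≋-trans (+ₚ-cong (+ₚ-comm (scaleₚ a r) (scaleₚ b p)) ≋-refl) (+ₚ-assoc (scaleₚ b p) (scaleₚ a r) _))))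

*ₚ-comm : ∀ p r → p *ₚ r ≋ r *ₚ p
*ₚ-comm [] r = ≋-sym (*ₚ-zeroʳ r)
*ₚ-comm (a ∷ p) r = ≋-trans (+ₚ-cong (≋-refl {scaleₚ a r}) (∷-cong ≡.refl (*ₚ-comm p r))) (≋-sym (*ₚ-∷ʳ r a p))

*ₚ-cong : ∀ {p p′ r r′} → p ≋ p′ → r ≋ r′ → p *ₚ r ≋ p′ *ₚ r′
*ₚ-cong {p} {p′} {r} {r′} p≋ r≋ =
  ≋-trans (*ₚ-congʳ p r≋) (≋-trans (*ₚ-comm p r′) (≋-trans (*ₚ-congʳ r′ p≋) (*ₚ-comm r′ p′)))

*ₚ-distribʳ : ∀ p r s → (r +ₚ s) *ₚ p ≋ r *ₚ p +ₚ s *ₚ p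
*ₚ-distribʳ p r s = ≋-trans (*ₚ-comm (r +ₚ s) p)
  (≋-trans (*ₚ-distribˡ p r s) (+ₚ-cong (*ₚ-comm p r) (*ₚ-comm p s)))

scale-*ₚ : ∀ a p r → scaleₚ a p *ₚ r ≋ scaleₚ a (p *ₚ r)
scale-*ₚ a [] r = ≋-refl
scale-*ₚ a (b ∷ p) r = ≋-trans
  (+ₚ-cong (≋-sym (scale-scale a b r)) (∷-cong (≡.sym (ℚ.*-zeroʳ a)) (scale-*ₚ a p r)))
  (≋-sym (scale-+ₚ a (scaleₚ b r) (0ℚ ∷ p *ₚ r)))

*ₚ-assoc : ∀ p r s → (p *ₚ r) *ₚ s ≋ p *ₚ (r *ₚ s)
*ₚ-assoc [] r s = ≋-refl
*ₚ-assoc (a ∷ p) r s = ≋-trans (*ₚ-distribʳ s (scaleₚ a r) (0ℚ ∷ p *ₚ r))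
  (+ₚ-cong (scale-*ₚ a r s) (+ₚ-cong (scale-0 s) (∷-cong ≡.refl (*ₚ-assoc p r s))))

*ₚ-identityˡ : ∀ p → oneₚ *ₚ p ≋ p
*ₚ-identityˡ p = ≋-trans (+ₚ-cong (scale-1 p) 0∷[]≋[]) (+ₚ-identityʳ p)

polyRing : CommutativeRing 0ℓ 0ℓ
polyRing = record
  { Carrier = Poly ; _≈_ = _≋_ ; _+_ = _+ₚ_ ; _*_ = _*ₚ_ ; -_ = -ₚ_ ; 0# = [] ; 1# = oneₚ
  ; isCommutativeRing = record
    { isRing = record
      { +-isAbelianGroup = record
        { isGroup = record
          { isMonoid = record
            { isSemigroup = record
              { isMagma = record
                { isEquivalence = record { refl = ≋-refl ; sym = ≋-sym ; trans = ≋-trans }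
                ; ∙-cong = +ₚ-cong }
              ; assoc = +ₚ-assoc }
            ; identity = (λ _ → ≋-refl) , +ₚ-identityʳ }
          ; inverse = (λ p → ≋-trans (+ₚ-comm (-ₚ p) p) (-ₚ-inverseʳ p)) , -ₚ-inverseʳ
          ; ⁻¹-cong = -ₚ-cong }
        ; comm = +ₚ-comm }
      ; *-cong = *ₚ-cong
      ; *-assoc = *ₚ-assoc
      ; *-identity = *ₚ-identityˡ , (λ p → ≋-trans (*ₚ-comm p oneₚ) (*ₚ-identityˡ p))
      ; distrib = *ₚ-distribˡ , *ₚ-distribʳ }
    ; *-comm = *ₚ-comm } }

qPow-suc : ∀ k → qPow (suc k) ≋ qPow 1 *ₚ qPow k
qPow-suc k = ≋-sym (+ₚ-cong (scale-0 (qPow k)) (∷-cong ≡.refl (*ₚ-identityˡ (qPow k))))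

coeff-qPow-* : ∀ g p i → coeff (qPow g *ₚ p) (g ℕ.+ i) ≡ coeff p i
coeff-qPow-* zero p i = *ₚ-identityˡ p .at i
coeff-qPow-* (suc g) p i = ≡.trans (+ₚ-cong (scale-0 p) (≋-refl {0ℚ ∷ qPow g *ₚ p}) .at (suc (g ℕ.+ i))) (coeff-qPow-* g p i)

coeff-beyond : ∀ p i → length p ℕ.≤ i → coeff p i ≡ 0ℚ
coeff-beyond [] i _ = ≡.refl
coeff-beyond (a ∷ p) (suc i) (s≤s l≤i) = coeff-beyond p i l≤i

-- A fixed point of multiplication by q^g has g-periodic coefficients, and they are eventually zero.
qPow-fixed : ∀ g p → 1 ℕ.≤ g → qPow g *ₚ p ≋ p → p ≋ []
qPow-fixed g p 1≤g fixed .at i = ≡.trans (periodic (length p))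
  (coeff-beyond p _ (ℕ.≤-trans (ℕ.≤-trans (ℕ.≤-reflexive (≡.sym (ℕ.*-identityʳ _))) (ℕ.*-monoʳ-≤ (length p) 1≤g)) (ℕ.m≤m+n _ i)))
  where
  periodic : ∀ k → coeff p i ≡ coeff p (k ℕ.* g ℕ.+ i)
  periodic zero = ≡.refl
  periodic (suc k) = begin
    coeff p i                                      ≡⟨ periodic k ⟩
    coeff p (k ℕ.* g ℕ.+ i)                        ≡⟨ coeff-qPow-* g p _ ⟨
    coeff (qPow g *ₚ p) (g ℕ.+ (k ℕ.* g ℕ.+ i))    ≡⟨ fixed .at _ ⟩
    coeff p (g ℕ.+ (k ℕ.* g ℕ.+ i))                ≡⟨ ≡.cong (coeff p) (ℕ.+-assoc g _ i) ⟨
    coeff p (suc k ℕ.* g ℕ.+ i)                    ∎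
    where open ≡.≡-Reasoning

module 𝒫 = CommutativeRing polyRing

-- If q^g - 1 annihilates `p -ₚ r`, this difference is fixed under multiplication by q^g, hence
-- zero.
qPow-1-cancel : ∀ g p r → 1 ℕ.≤ g → (qPow g -ₚ oneₚ) *ₚ p ≋ (qPow g -ₚ oneₚ) *ₚ r → p ≋ r
qPow-1-cancel g p r 1≤g eq = begin
  p             ≈⟨ solve 2 (λ p r → p := (p :- r) :+ r) 𝒫.refl p r ⟩
  p -ₚ r +ₚ r   ≈⟨ +ₚ-cong (qPow-fixed g (p -ₚ r) 1≤g fixed) ≋-refl ⟩
  r             ∎
  where
  open ℤ-Solver polyRing
  open import Relation.Binary.Reasoning.Setoid 𝒫.setoid
  Q = qPow g
  fixed : Q *ₚ (p -ₚ r) ≋ p -ₚ r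
  fixed = begin
    Q *ₚ (p -ₚ r)
      ≈⟨ solve 3 (λ Q p r → Q :* (p :- r) := (Q :- :1) :* p :- (Q :- :1) :* r :+ (p :- r)) 𝒫.refl Q p r ⟩
    (Q -ₚ oneₚ) *ₚ p -ₚ (Q -ₚ oneₚ) *ₚ r +ₚ (p -ₚ r)
      ≈⟨ +ₚ-cong (≋-trans (+ₚ-cong eq ≋-refl) (-ₚ-inverseʳ ((Q -ₚ oneₚ) *ₚ r))) ≋-refl ⟩
    p -ₚ r ∎

open Mult 𝒫.semiring using () renaming (_×_ to _·ₚ_)

-- Characteristic zero: `κ k` is the integer `k` inside ℚ, and its positivity for `k > 0` makes it
-- invertible.
·ₚ1-unit : ∀ k → ∃ λ p → (suc k ·ₚ oneₚ) *ₚ p ≋ oneₚ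
·ₚ1-unit k = ℚ.1/ κ (suc k) ∷ [] , ≋-trans (*ₚ-cong (≋-κ (suc k)) ≋-refl)
  (∷-cong (≡.trans (ℚ.+-identityʳ _) (ℚ.*-inverseʳ (κ (suc k)))) ≋-refl)
  where
  κ : ℕ → ℚ
  κ zero = 0ℚ
  κ (suc k) = 1ℚ ℚ.+ κ k
  κ≥0 : ∀ k → 0ℚ ℚ.≤ κ k
  κ>0 : ∀ k → 0ℚ ℚ.< κ (suc k)
  κ≥0 zero = ℚ.≤-refl
  κ≥0 (suc k) = ℚ.<⇒≤ (κ>0 k)
  κ>0 k = ℚ.+-mono-<-≤ (ℚ.positive⁻¹ 1ℚ) (κ≥0 k)
  instance
    κ≢0 : ℚ.NonZero (κ (suc k))
    κ≢0 = ℚ.>-nonZero (κ>0 k)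
  ≋-κ : ∀ k → k ·ₚ oneₚ ≋ κ k ∷ []
  ≋-κ zero = ≋-sym 0∷[]≋[]
  ≋-κ (suc k) = +ₚ-cong (≋-refl {oneₚ}) (≋-κ k)

-- Quotient rings and units

module Quotient {c ℓ} (R : CommutativeRing c ℓ) (P : CommutativeRing.Carrier R) where
  open CommutativeRing R
  open ℤ-Solver R
  open import Relation.Binary.Reasoning.Setoid setoid

  infix 4 _∼_
  record _∼_ (x y : Carrier) : Set (c ⊔ ℓ) where
    constructor modulo
    field
      quotient : Carrier
      equation : x ≈ y + P * quotient

  ≈⇒∼ : ∀ {x y} → x ≈ y → x ∼ y
  ≈⇒∼ {x} {y} x≈y = modulo 0# (trans x≈y (solve 2 (λ y P → y := y :+ P :* :0) refl y P))

  ∼-sym : ∀ {x y} → x ∼ y → y ∼ x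
  ∼-sym {x} {y} (modulo u x≈) = modulo (- u)
    (trans (solve 3 (λ y P u → y := (y :+ P :* u) :+ P :* :- u) refl y P u) (+-congʳ (sym x≈)))

  ∼-trans : ∀ {x y z} → x ∼ y → y ∼ z → x ∼ z
  ∼-trans {z = z} (modulo u x≈) (modulo v y≈) = modulo (u + v)
    (trans x≈ (trans (+-congʳ y≈) (solve 4 (λ z P u v → z :+ P :* v :+ P :* u := z :+ P :* (u :+ v)) refl z P u v)))

  +-cong-∼ : ∀ {x x′ y y′} → x ∼ x′ → y ∼ y′ → x + y ∼ x′ + y′
  +-cong-∼ {x′ = x} {y′ = y} (modulo u x≈) (modulo v y≈) = modulo (u + v) (trans (+-cong x≈ y≈)
    (solve 5 (λ x y P u v → (x :+ P :* u) :+ (y :+ P :* v) := (x :+ y) :+ P :* (u :+ v)) refl x y P u v))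

  *-cong-∼ : ∀ {x x′ y y′} → x ∼ x′ → y ∼ y′ → x * y ∼ x′ * y′
  *-cong-∼ {x′ = x} {y′ = y} (modulo u x≈) (modulo v y≈) = modulo (x * v + u * y + u * P * v) (trans (*-cong x≈ y≈)
    (solve 5 (λ x y P u v → (x :+ P :* u) :* (y :+ P :* v) := x :* y :+ P :* (x :* v :+ u :* y :+ u :* P :* v)) refl x y P u v))

  -‿cong-∼ : ∀ {x y} → x ∼ y → - x ∼ - y
  -‿cong-∼ {y = y} (modulo u x≈) = modulo (- u) (trans (-‿cong x≈)
    (solve 3 (λ y P u → :- (y :+ P :* u) := :- y :+ P :* :- u) refl y P u))

  quotientRing : CommutativeRing c (c ⊔ ℓ)
  quotientRing = record
    { Carrier = Carrier ; _≈_ = _∼_ ; _+_ = _+_ ; _*_ = _*_ ; -_ = -_ ; 0# = 0# ; 1# = 1#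
    ; isCommutativeRing = record
      { isRing = record
        { +-isAbelianGroup = record
          { isGroup = record
            { isMonoid = record
              { isSemigroup = record
                { isMagma = record
                  { isEquivalence = record { refl = ≈⇒∼ refl ; sym = ∼-sym ; trans = ∼-trans }
                  ; ∙-cong = +-cong-∼ }
                ; assoc = λ x y z → ≈⇒∼ (+-assoc x y z) }
              ; identity = (λ x → ≈⇒∼ (+-identityˡ x)) , (λ x → ≈⇒∼ (+-identityʳ x)) }
            ; inverse = (λ x → ≈⇒∼ (-‿inverseˡ x)) , (λ x → ≈⇒∼ (-‿inverseʳ x))
            ; ⁻¹-cong = -‿cong-∼ }
          ; comm = λ x y → ≈⇒∼ (+-comm x y) }
        ; *-cong = *-cong-∼
        ; *-assoc = λ x y z → ≈⇒∼ (*-assoc x y z)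
        ; *-identity = (λ x → ≈⇒∼ (*-identityˡ x)) , (λ x → ≈⇒∼ (*-identityʳ x))
        ; distrib = (λ x y z → ≈⇒∼ (distribˡ x y z)) , (λ x y z → ≈⇒∼ (distribʳ x y z)) }
      ; *-comm = λ x y → ≈⇒∼ (*-comm x y) } }

module Units {c ℓ} (R : CommutativeRing c ℓ) where
  open CommutativeRing R
  open ℤ-Solver R
  open Exp semiring
  open Mult semiring using () renaming (_×_ to _·_)
  open Pochhammer R using (poch)
  open import Relation.Binary.Reasoning.Setoid setoid

  record Unit (x : Carrier) : Set (c ⊔ ℓ) where
    constructor unit
    field
      reciprocal : Carrier
      *-reciprocal : x * reciprocal ≈ 1#

  unit-cong : ∀ {x y} → x ≈ y → Unit x → Unit y
  unit-cong x≈y (unit u xu≈1) = unit u (trans (*-congʳ (sym x≈y)) xu≈1)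

  unit-1 : Unit 1#
  unit-1 = unit 1# (*-identityˡ 1#)

  unit-* : ∀ {x y} → Unit x → Unit y → Unit (x * y)
  unit-* {x} {y} (unit u xu≈1) (unit v yv≈1) = unit (u * v) (begin
    x * y * (u * v)     ≈⟨ solve 4 (λ x y u v → x :* y :* (u :* v) := x :* u :* (y :* v)) refl x y u v ⟩
    x * u * (y * v)     ≈⟨ *-cong xu≈1 yv≈1 ⟩
    1# * 1#             ≈⟨ *-identityˡ 1# ⟩
    1#                  ∎)

  unit-^ : ∀ {x} k → Unit x → Unit (x ^ k)
  unit-^ zero ux = unit-1
  unit-^ (suc k) ux = unit-* ux (unit-^ k ux)

  unit-factor : ∀ {x z} y → x * y ≈ z → Unit z → Unit x
  unit-factor y xy≈z (unit u zu≈1) = unit (y * u) (trans (sym (*-assoc _ _ _)) (trans (*-congʳ xy≈z) zu≈1))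

  module Reciprocals (K : ℕ) (f : ℕ → Carrier) (units : ∀ k → k ℕ.≤ K → Unit (f k)) where
    -- Arbitrary for k > K.
    inv : ℕ → Carrier
    inv k with k ℕ.≤? K
    ... | yes k≤K = Unit.reciprocal (units k k≤K)
    ... | no _ = 0#

    inverse : ∀ k → k ℕ.≤ K → f k * inv k ≈ 1#
    inverse k k≤K with k ℕ.≤? K
    ... | yes k≤K′ = Unit.*-reciprocal (units k k≤K′)
    ... | no k≰K = contradiction k≤K k≰K

  unit-poch : ∀ x p k → (∀ j → j ℕ.< k → Unit (1# - x * p ^ j)) → Unit (poch x p k)
  unit-poch x p zero units = unit-1
  unit-poch x p (suc k) units =
    unit-* (unit-poch x p k (λ j j<k → units j (ℕ.m<n⇒m<1+n j<k))) (units k ℕ.≤-refl)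

  geometric : ∀ x k → ∃ λ g → (x ^ k - 1# ≈ (x - 1#) * g) × ∃ λ f → g ≈ k · 1# + (x - 1#) * f
  geometric x zero = 0# , solve 1 (λ x → :1 :- :1 := (x :- :1) :* :0) refl x
    , 0# , solve 1 (λ x → :0 := :0 :+ (x :- :1) :* :0) refl x
  geometric x (suc k) with geometric x k
  ... | g , xᵏ-1≈ , f , g≈ = 1# + x * g , (begin
      x * x ^ k - 1#
        ≈⟨ solve 2 (λ x P → x :* P :- :1 := (x :- :1) :+ x :* (P :- :1)) refl x (x ^ k) ⟩
      (x - 1#) + x * (x ^ k - 1#)           ≈⟨ +-congˡ (*-congˡ xᵏ-1≈) ⟩
      (x - 1#) + x * ((x - 1#) * g)
        ≈⟨ solve 2 (λ x g → (x :- :1) :+ x :* ((x :- :1) :* g) := (x :- :1) :* (:1 :+ x :* g)) refl x g ⟩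
      (x - 1#) * (1# + x * g)               ∎)
    , f + g , (begin
      1# + x * g                            ≈⟨ solve 2 (λ x g → :1 :+ x :* g := :1 :+ g :+ (x :- :1) :* g) refl x g ⟩
      1# + g + (x - 1#) * g                 ≈⟨ +-congʳ (+-congˡ g≈) ⟩
      1# + (k · 1# + (x - 1#) * f) + (x - 1#) * g
        ≈⟨ solve 4 (λ t x f g → :1 :+ (t :+ (x :- :1) :* f) :+ (x :- :1) :* g := :1 :+ t :+ (x :- :1) :* (f :+ g)) refl (k · 1#) x f g ⟩
      1# + k · 1# + (x - 1#) * (f + g)      ∎)

  -- (x^k − 1)/(x − 1) = 1 + x + ⋯ + x^(k−1) is k modulo x − 1.
  geometric-comaximal : ∀ x k P w → (∀ y z → (x - 1#) * y ≈ (x - 1#) * z → y ≈ z) →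
    x ^ k - 1# ≈ (x - 1#) * (P * w) → ∃ λ f → ∃ λ v → (x - 1#) * f ≈ k · 1# + P * v
  geometric-comaximal x k P w cancel xᵏ-1≈ with geometric x k
  ... | g , xᵏ-1≈′ , f , g≈ = - f , - w , (begin
    (x - 1#) * - f
      ≈⟨ solve 3 (λ X f k → X :* :- f := k :- (k :+ X :* f)) refl (x - 1#) f (k · 1#) ⟩
    k · 1# - (k · 1# + (x - 1#) * f)
      ≈⟨ +-congˡ (-‿cong (trans (sym g≈) (cancel g (P * w) (trans (sym xᵏ-1≈′) xᵏ-1≈)))) ⟩
    k · 1# - P * w      ≈⟨ solve 3 (λ P w k → k :- P :* w := k :+ P :* :- w) refl P w (k · 1#) ⟩
    k · 1# + P * - w    ∎)

  unit-root : ∀ x k → Unit (x ^ k - 1#) → Unit (x - 1#)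
  unit-root x k with geometric x k
  ... | g , xᵏ-1≈ , _ = unit-factor g (sym xᵏ-1≈)

  unit-1-x : ∀ {x} → Unit (x - 1#) → Unit (1# - x)
  unit-1-x {x} = unit-factor (- 1#) (solve 1 (λ x → (:1 :- x) :* :- :1 := x :- :1) refl x)

  ^-multiple : ∀ {q n} → q ^ n ≈ 1# → ∀ k → q ^ (k ℕ.* n) ≈ 1#
  ^-multiple qⁿ≈1 zero = refl
  ^-multiple {q} {n} qⁿ≈1 (suc k) =
    trans (^-homo-* q n (k ℕ.* n)) (trans (*-cong qⁿ≈1 (^-multiple qⁿ≈1 k)) (*-identityˡ 1#))

  -- If gcd(j, n) = g, then q^j − 1 divides q^g − 1 as soon as q^n = 1.
  unit-gcd : ∀ {q n} j → q ^ n ≈ 1# → Unit (q ^ gcd j n - 1#) → Unit (q ^ j - 1#)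
  unit-gcd {q} {n} j qⁿ≈1 u with Bézout.identity (gcd-GCD j n)
  ... | Bézout.+- x y g+yn≡xj with geometric (q ^ j) x
  ... | f , qʲˣ-1≈ , _ = unit-factor f (begin
    (q ^ j - 1#) * f                       ≈⟨ qʲˣ-1≈ ⟨
    (q ^ j) ^ x - 1#                       ≈⟨ +-congʳ (^-assocʳ q j x) ⟩
    q ^ (j ℕ.* x) - 1#                     ≡⟨ ≡.cong (λ i → q ^ i - 1#) (≡.trans (ℕ.*-comm j x) (≡.sym g+yn≡xj)) ⟩
    q ^ (gcd j n ℕ.+ y ℕ.* n) - 1#         ≈⟨ +-congʳ (^-homo-* q (gcd j n) (y ℕ.* n)) ⟩
    q ^ gcd j n * q ^ (y ℕ.* n) - 1#       ≈⟨ +-congʳ (*-congˡ (^-multiple qⁿ≈1 y)) ⟩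
    q ^ gcd j n * 1# - 1#                  ≈⟨ +-congʳ (*-identityʳ _) ⟩
    q ^ gcd j n - 1#                       ∎) u
  -- In this case g + x j = y n, so q^g and q^(j x) are mutually inverse and q^g - 1 = -q^g (q^(j x)
  -- - 1).
  unit-gcd {q} {n} j qⁿ≈1 u | Bézout.-+ x y g+xj≡yn with geometric (q ^ j) x
  ... | f , qʲˣ-1≈ , _ = unit-factor (- (q ^ gcd j n) * f) (begin
    (q ^ j - 1#) * (- (q ^ gcd j n) * f)
      ≈⟨ solve 3 (λ a g f → a :* (:- g :* f) := :- g :* (a :* f)) refl (q ^ j - 1#) (q ^ gcd j n) f ⟩
    - (q ^ gcd j n) * ((q ^ j - 1#) * f)   ≈⟨ *-congˡ qʲˣ-1≈ ⟨
    - (q ^ gcd j n) * ((q ^ j) ^ x - 1#)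
      ≈⟨ solve 2 (λ g a → :- g :* (a :- :1) := g :- g :* a) refl (q ^ gcd j n) ((q ^ j) ^ x) ⟩
    q ^ gcd j n - q ^ gcd j n * (q ^ j) ^ x   ≈⟨ +-congˡ (-‿cong q^gqʲˣ≈1) ⟩
    q ^ gcd j n - 1#                       ∎) u
    where
    q^gqʲˣ≈1 : q ^ gcd j n * (q ^ j) ^ x ≈ 1#
    q^gqʲˣ≈1 = begin
      q ^ gcd j n * (q ^ j) ^ x          ≈⟨ *-congˡ (^-assocʳ q j x) ⟩
      q ^ gcd j n * q ^ (j ℕ.* x)        ≈⟨ ^-homo-* q (gcd j n) (j ℕ.* x) ⟨
      q ^ (gcd j n ℕ.+ j ℕ.* x)          ≡⟨ ≡.cong (q ^_) (≡.trans (≡.cong (gcd j n ℕ.+_) (ℕ.*-comm j x)) g+xj≡yn) ⟩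
      q ^ (y ℕ.* n)                      ≈⟨ ^-multiple qⁿ≈1 y ⟩
      1#                                 ∎

-- Cyclotomic polynomials

qPow≋q^ : ∀ k → qPow k ≋ Exp._^_ 𝒫.semiring (qPow 1) k
qPow≋q^ zero = ≋-refl
qPow≋q^ (suc k) = ≋-trans (qPow-suc k) (*ₚ-congʳ (qPow 1) (qPow≋q^ k))

module Cyclotomic (Φ : ℕ → Poly) (cyclotomic : IsCyclotomicFamily Φ) where
  open import Relation.Binary.Reasoning.Setoid 𝒫.setoid
  open ℤ-Solver polyRing

  Π : ℕ → ℕ → Poly
  Π n k = prodₚ (map Φ (filter (_∣? n) (upTo k)))

  prodₚ-++ : ∀ ps rs → prodₚ (ps ++ rs) ≋ prodₚ ps *ₚ prodₚ rs
  prodₚ-++ [] rs = ≋-sym (*ₚ-identityˡ _)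
  prodₚ-++ (p ∷ ps) rs = ≋-trans (*ₚ-congʳ p (prodₚ-++ ps rs)) (≋-sym (*ₚ-assoc p _ _))

  Π-suc : ∀ n k → Π n (suc k) ≋ Π n k *ₚ prodₚ (map Φ (filter (_∣? n) (k ∷ [])))
  Π-suc n k = begin
    Π n (suc k)                                                       ≡⟨ ≡.cong (λ ks → prodₚ (map Φ (filter (_∣? n) ks))) (upTo-∷ʳ k) ⟨
    prodₚ (map Φ (filter (_∣? n) (upTo k ++ k ∷ [])))                 ≡⟨ ≡.cong (λ ks → prodₚ (map Φ ks)) (filter-++ (_∣? n) (upTo k) _) ⟩
    prodₚ (map Φ (filter (_∣? n) (upTo k) ++ filter (_∣? n) (k ∷ [])))
      ≡⟨ ≡.cong prodₚ (map-++ Φ (filter (_∣? n) (upTo k)) _) ⟩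
    prodₚ (map Φ (filter (_∣? n) (upTo k)) ++ map Φ (filter (_∣? n) (k ∷ [])))
      ≈⟨ prodₚ-++ (map Φ (filter (_∣? n) (upTo k))) _ ⟩
    Π n k *ₚ prodₚ (map Φ (filter (_∣? n) (k ∷ [])))                  ∎

  Π-∣ : ∀ {n k} → k ∣ n → Π n (suc k) ≋ Π n k *ₚ Φ k
  Π-∣ {n} {k} k∣n = ≋-trans (Π-suc n k) (*ₚ-congʳ (Π n k)
    (≋-trans (𝒫.reflexive (≡.cong (λ ks → prodₚ (map Φ ks)) (filter-accept (_∣? n) k∣n)))
             (𝒫.*-identityʳ (Φ k))))

  Π-∤ : ∀ {n k} → ¬ k ∣ n → Π n (suc k) ≋ Π n k
  Π-∤ {n} {k} k∤n = ≋-trans (Π-suc n k) (≋-trans (*ₚ-congʳ (Π n k)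
    (𝒫.reflexive (≡.cong (λ ks → prodₚ (map Φ ks)) (filter-reject (_∣? n) k∤n))))
    (𝒫.*-identityʳ (Π n k)))

  -- Divisors of `g` are divisors of `n`; the cofactor collects the `Φ j` with `j` dividing `n` but
  -- not `g`.
  Π-factor : ∀ {g n} → g ∣ n → ∀ k → ∃ λ w → Π n k ≋ Π g k *ₚ w
  Π-factor g∣n zero = oneₚ , ≋-sym (𝒫.*-identityʳ oneₚ)
  Π-factor {g} {n} g∣n (suc k) with Π-factor g∣n k | k ∣? g | k ∣? n
  ... | w , eq | yes k∣g | yes k∣n = w , (begin
    Π n (suc k)              ≈⟨ Π-∣ k∣n ⟩
    Π n k *ₚ Φ k             ≈⟨ *ₚ-cong eq ≋-refl ⟩
    Π g k *ₚ w *ₚ Φ k        ≈⟨ solve 3 (λ a b c → a :* b :* c := a :* c :* b) 𝒫.refl (Π g k) w (Φ k) ⟩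
    Π g k *ₚ Φ k *ₚ w        ≈⟨ *ₚ-cong (Π-∣ k∣g) ≋-refl ⟨
    Π g (suc k) *ₚ w         ∎)
  ... | _ | yes k∣g | no k∤n = contradiction (ℕ.∣-trans k∣g g∣n) k∤n
  ... | w , eq | no k∤g | yes k∣n = w *ₚ Φ k , (begin
    Π n (suc k)              ≈⟨ Π-∣ k∣n ⟩
    Π n k *ₚ Φ k             ≈⟨ *ₚ-cong eq ≋-refl ⟩
    Π g k *ₚ w *ₚ Φ k        ≈⟨ *ₚ-assoc (Π g k) w (Φ k) ⟩
    Π g k *ₚ (w *ₚ Φ k)      ≈⟨ *ₚ-cong (Π-∤ k∤g) ≋-refl ⟨
    Π g (suc k) *ₚ (w *ₚ Φ k) ∎)
  ... | w , eq | no k∤g | no k∤n = w , ≋-trans (Π-∤ k∤n) (≋-trans eq (*ₚ-cong (≋-sym (Π-∤ k∤g)) ≋-refl))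

  -- No divisor of `n` exceeds `n`, so the bound can be lowered to `suc n`, where the product is the
  -- one in `IsCyclotomicFamily`.
  Π-complete : ∀ {n} → 1 ℕ.≤ n → ∀ k → n ℕ.< k → Π n k ≋ qPow n -ₚ oneₚ
  Π-complete {n} 1≤n (suc k) n<1+k with ℕ.m≤n⇒m<n∨m≡n (ℕ.s≤s⁻¹ n<1+k)
  ... | inj₂ ≡.refl = coefficientwise (cyclotomic n 1≤n)
  ... | inj₁ n<k = ≋-trans (Π-∤ (λ k∣n → ℕ.<⇒≱ n<k (ℕ.∣⇒≤ {{ℕ.>-nonZero 1≤n}} k∣n))) (Π-complete 1≤n k n<k)

  Φ-factor : ∀ {n} → 1 ℕ.≤ n → ∃ λ w → qPow n -ₚ oneₚ ≋ Φ n *ₚ w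
  Φ-factor {n} 1≤n = Π n n , ≋-trans (≋-sym (Π-complete 1≤n (suc n) ℕ.≤-refl))
    (≋-trans (Π-∣ {n} (ℕ.∣-refl {n})) (*ₚ-comm (Π n n) (Φ n)))

  -- The product over the divisors of `n` below `n` already contains all divisors of `g`, so `Φ n`
  -- is a factor besides q^g - 1.
  Φ-factor-proper : ∀ {g n} → 1 ℕ.≤ g → g ∣ n → g ℕ.< n → ∃ λ w → qPow n -ₚ oneₚ ≋ (qPow g -ₚ oneₚ) *ₚ (Φ n *ₚ w)
  Φ-factor-proper {g} {n} 1≤g g∣n g<n with Π-factor g∣n n
  ... | w , eq = w , (begin
    qPow n -ₚ oneₚ                       ≈⟨ Π-complete (ℕ.≤-trans 1≤g (ℕ.<⇒≤ g<n)) (suc n) ℕ.≤-refl ⟨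
    Π n (suc n)                          ≈⟨ Π-∣ {n} (ℕ.∣-refl {n}) ⟩
    Π n n *ₚ Φ n                         ≈⟨ *ₚ-cong (≋-trans eq (*ₚ-cong (Π-complete 1≤g n g<n) ≋-refl)) ≋-refl ⟩
    (qPow g -ₚ oneₚ) *ₚ w *ₚ Φ n         ≈⟨ solve 3 (λ a w f → a :* w :* f := a :* (f :* w)) 𝒫.refl (qPow g -ₚ oneₚ) w (Φ n) ⟩
    (qPow g -ₚ oneₚ) *ₚ (Φ n *ₚ w)       ∎)

  -- Here `suc c` is n/g: `Φ n` divides (q^n - 1)/(q^g - 1), which is n/g modulo q^g - 1.
  comaximal : ∀ {g n} → 1 ℕ.≤ g → g ∣ n → g ℕ.< n →
    ∃ λ c → ∃ λ f → ∃ λ w → (qPow g -ₚ oneₚ) *ₚ f ≋ suc c ·ₚ oneₚ +ₚ Φ n *ₚ w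
  comaximal 1≤g (divides zero ≡.refl) ()
  comaximal {g} {n} 1≤g g∣n@(divides (suc c) n≡) g<n = c ,
    Units.geometric-comaximal polyRing (qPow g) (suc c) (Φ n) w (λ y z → qPow-1-cancel g y z 1≤g) (begin
      qPow g ^ suc c -ₚ oneₚ                   ≈⟨ +ₚ-cong (^-congˡ (suc c) (qPow≋q^ g)) ≋-refl ⟩
      (qPow 1 ^ g) ^ suc c -ₚ oneₚ             ≈⟨ +ₚ-cong (^-assocʳ (qPow 1) g (suc c)) ≋-refl ⟩
      qPow 1 ^ (g ℕ.* suc c) -ₚ oneₚ           ≡⟨ ≡.cong (λ j → qPow 1 ^ j -ₚ oneₚ) (≡.trans (ℕ.*-comm g (suc c)) (≡.sym n≡)) ⟩
      qPow 1 ^ n -ₚ oneₚ                       ≈⟨ +ₚ-cong (qPow≋q^ n) ≋-refl ⟨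
      qPow n -ₚ oneₚ                           ≈⟨ proj₂ (Φ-factor-proper 1≤g g∣n g<n) ⟩
      (qPow g -ₚ oneₚ) *ₚ (Φ n *ₚ w)           ∎)
    where
    open Exp 𝒫.semiring
    w = proj₁ (Φ-factor-proper 1≤g g∣n g<n)

-- Fractions and congruences in quotients of ℚ[q]

q : Poly
q = qPow 1

module PolyQuotient (P : Poly) where
  open Quotient polyRing P public
  open CommutativeRing quotientRing public
    using (refl; sym; trans; reflexive; semiring; commutativeSemiring; *-cong; *-congʳ; +-cong; +-congˡ; +-congʳ;
           -‿cong; *-identityˡ; *-identityʳ; *-comm; setoid; 1#; _*_; _-_)
  open Exp semiring public
  open Mult semiring public using () renaming (_×_ to _·_)
  open Pochhammer quotientRing public using (poch; poch-cong)
  open Sums quotientRing public using (sum)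
  open Units quotientRing public
  open ℤ-Solver quotientRing public
  open import Relation.Binary.Reasoning.Setoid setoid public

  ^ₚ≡^ : ∀ p k → p ^ₚ k ≡ p ^ k
  ^ₚ≡^ p zero = ≡.refl
  ^ₚ≡^ p (suc k) = ≡.cong (p *ₚ_) (^ₚ≡^ p k)

  ·ₚ≡· : ∀ k → k ·ₚ oneₚ ≡ k · oneₚ
  ·ₚ≡· zero = ≡.refl
  ·ₚ≡· (suc k) = ≡.cong (oneₚ +ₚ_) (·ₚ≡· k)

  qPow∼q^ : ∀ k → qPow k ∼ q ^ k
  qPow∼q^ zero = refl
  qPow∼q^ (suc k) = trans (≈⇒∼ (qPow-suc k)) (*-cong (refl {q}) (qPow∼q^ k))

  qPoch∼poch : ∀ a b k → qPoch a b k ∼ poch (q ^ a) (q ^ b) k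
  qPoch∼poch a b zero = refl
  qPoch∼poch a b (suc k) = *-cong (qPoch∼poch a b k) (+-congˡ (-‿cong (begin
    qPow (a ℕ.+ b ℕ.* k)        ≈⟨ qPow∼q^ (a ℕ.+ b ℕ.* k) ⟩
    q ^ (a ℕ.+ b ℕ.* k)         ≈⟨ ^-homo-* q a (b ℕ.* k) ⟩
    q ^ a * q ^ (b ℕ.* k)       ≈⟨ *-cong (refl {q ^ a}) (^-assocʳ q b k) ⟨
    q ^ a * (q ^ b) ^ k         ∎)))

  unit⇒coprime : ∀ {V} → Unit V → Coprime V P
  unit⇒coprime {V} (unit u (modulo w eq)) = u , -ₚ w , _≋_.at (≋-trans
    (𝒮.solve 4 (λ V u P w → u 𝒮.:* V 𝒮.:+ (𝒮.:- w) 𝒮.:* P 𝒮.:= V 𝒮.:* u 𝒮.:- P 𝒮.:* w) 𝒫.refl V u P w)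
    (≋-trans (+ₚ-cong eq ≋-refl)
    (𝒮.solve 2 (λ P w → (𝒮.:1 𝒮.:+ P 𝒮.:* w) 𝒮.:- P 𝒮.:* w 𝒮.:= 𝒮.:1) 𝒫.refl P w)))
    where module 𝒮 = ℤ-Solver polyRing

  -- A fraction has value `T` when its numerator is its denominator times `T`; in this form values
  -- add without any division.
  sumF-value : ∀ n f T → (∀ k → k ℕ.< n → num (f k) ∼ den (f k) *ₚ T k) →
               num (sumF n f) ∼ den (sumF n f) *ₚ sum n T
  sumF-value zero f T values = sym (*-identityˡ [])
  sumF-value (suc n) f T values = begin
    num (sumF n f) *ₚ den (f n) +ₚ num (f n) *ₚ den (sumF n f)
      ≈⟨ +-cong (*-congʳ (sumF-value n f T (λ k k<n → values k (ℕ.m<n⇒m<1+n k<n)))) (*-congʳ (values n ℕ.≤-refl)) ⟩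
    den (sumF n f) *ₚ sum n T *ₚ den (f n) +ₚ den (f n) *ₚ T n *ₚ den (sumF n f)
      ≈⟨ solve 4 (λ a s b t → a :* s :* b :+ b :* t :* a := a :* b :* (s :+ t)) refl (den (sumF n f)) (sum n T) (den (f n)) (T n) ⟩
    den (sumF n f) *ₚ den (f n) *ₚ (sum n T +ₚ T n) ∎

  sumF-unit : ∀ n f → (∀ k → k ℕ.< n → Unit (den (f k))) → Unit (den (sumF n f))
  sumF-unit zero f units = unit-1
  sumF-unit (suc n) f units = unit-* (sumF-unit n f (λ k k<n → units k (ℕ.m<n⇒m<1+n k<n))) (units n ℕ.≤-refl)

  -- The product of the denominators serves as V: it is a unit, hence coprime to the modulus, and it
  -- matches the denominators on the right of `CongMod`, so that U is the quotient witnessing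
  -- `cross`.
  congMod : ∀ A B {S T} → num A ∼ den A *ₚ S → num B ∼ den B *ₚ T → S ∼ T →
            Unit (den A) → Unit (den B) → CongMod A B P
  congMod A B {S} {T} A∼ B∼ S∼T uA uB = u , den A *ₚ den B , unit⇒coprime (unit-* uA uB) , _≋_.at (≋-trans
    (*ₚ-cong (+ₚ-cong eq ≋-refl) ≋-refl)
    (𝒮.solve 5 (λ n P u a b → (n 𝒮.:+ P 𝒮.:* u 𝒮.:- n) 𝒮.:* (a 𝒮.:* b) 𝒮.:= P 𝒮.:* u 𝒮.:* a 𝒮.:* b)
      𝒫.refl (num B *ₚ den A) P u (den A) (den B)))
    where
    module 𝒮 = ℤ-Solver polyRing
    cross : num A *ₚ den B ∼ num B *ₚ den A
    cross = begin
      num A *ₚ den B            ≈⟨ *-congʳ (trans A∼ (*-cong (refl {den A}) S∼T)) ⟩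
      den A *ₚ T *ₚ den B       ≈⟨ solve 3 (λ a t b → a :* t :* b := b :* t :* a) refl (den A) T (den B) ⟩
      den B *ₚ T *ₚ den A       ≈⟨ *-congʳ B∼ ⟨
      num B *ₚ den A            ∎
    u = _∼_.quotient cross
    eq = _∼_.equation cross

-- One Hensel step: x y = 1 + P u gives x y (1 - P u) = 1 - P² u².
unit-square : ∀ {P x} → PolyQuotient.Unit P x → PolyQuotient.Unit (P ^ₚ 2) x
unit-square {P} {x} (Units.unit y (Quotient.modulo u xy≈)) = Units.unit (y *ₚ (oneₚ -ₚ P *ₚ u)) (Quotient.modulo (-ₚ (u *ₚ u)) (≋-trans
  (≋-sym (*ₚ-assoc x y _)) (≋-trans (*ₚ-cong xy≈ ≋-refl)
  (solve 2 (λ P u → (:1 :+ P :* u) :* (:1 :- P :* u) := :1 :+ P :* (P :* :1) :* (:- (u :* u))) 𝒫.refl P u))))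
  where open ℤ-Solver polyRing

-- Units modulo a cyclotomic polynomial

module CyclotomicUnits (Φ : ℕ → Poly) (cyclotomic : IsCyclotomicFamily Φ) (n : ℕ) (1≤n : 1 ≤ n) where
  open Cyclotomic Φ cyclotomic
  open PolyQuotient (Φ n)

  unit-proper-divisor : ∀ g → 1 ≤ g → g ∣ n → g ℕ.< n → Unit (qPow g -ₚ oneₚ)
  unit-proper-divisor g 1≤g g∣n g<n = unit-factor f (modulo w eq) (unit (proj₁ (·ₚ1-unit c)) (≈⇒∼ (proj₂ (·ₚ1-unit c))))
    where
    bezout = comaximal 1≤g g∣n g<n
    c = proj₁ bezout
    f = proj₁ (proj₂ bezout)
    w = proj₁ (proj₂ (proj₂ bezout))
    eq = proj₂ (proj₂ (proj₂ bezout))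

  qⁿ∼1 : q ^ n ∼ 1#
  qⁿ∼1 = trans (sym (qPow∼q^ n)) (modulo (proj₁ (Φ-factor 1≤n)) (≋-trans
    (𝒮.solve 1 (λ x → x 𝒮.:= 𝒮.:1 𝒮.:+ (x 𝒮.:- 𝒮.:1)) 𝒫.refl (qPow n))
    (+ₚ-cong (≋-refl {oneₚ}) (proj₂ (Φ-factor 1≤n)))))
    where module 𝒮 = ℤ-Solver polyRing

  -- The greatest common divisor of `j` and `n` is at most `j`, hence a proper divisor of `n`, to
  -- which `comaximal` applies.
  unit-q^-1 : ∀ j → 1 ≤ j → j ℕ.< n → Unit (q ^ j - 1#)
  unit-q^-1 j 1≤j j<n = unit-gcd {q} {n} j qⁿ∼1 (unit-cong (+-congʳ (qPow∼q^ g))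
    (unit-proper-divisor g 1≤g (gcd[m,n]∣n j n) (ℕ.≤-<-trans g≤j j<n)))
    where
    g = gcd j n
    instance
      j≢0 : ℕ.NonZero j
      j≢0 = ℕ.>-nonZero 1≤j
    g≤j : g ≤ j
    g≤j = ℕ.∣⇒≤ (gcd[m,n]∣m j n)
    1≤g : 1 ≤ g
    1≤g = ℕ.n≢0⇒n>0 (gcd[m,n]≢0 j n (inj₁ (ℕ.≢-nonZero⁻¹ j)))

  -- Since d m = n + 1, (q^(d j))^m = q^j modulo Φ n.
  unit-1-qPow : ∀ d m j → d ℕ.* m ≡ suc n → 1 ≤ j → j ℕ.< n → Unit (oneₚ -ₚ qPow (d ℕ.* j))
  unit-1-qPow d m j dm≡1+n 1≤j j<n = unit-1-x (unit-cong (+-congʳ (sym (qPow∼q^ (d ℕ.* j))))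
    (unit-root (q ^ (d ℕ.* j)) m (unit-cong (+-congʳ (sym X^m∼q^j)) (unit-q^-1 j 1≤j j<n))))
    where
    X^m∼q^j : (q ^ (d ℕ.* j)) ^ m ∼ q ^ j
    X^m∼q^j = begin
      (q ^ (d ℕ.* j)) ^ m          ≈⟨ ^-assocʳ q (d ℕ.* j) m ⟩
      q ^ (d ℕ.* j ℕ.* m)          ≡⟨ ≡.cong (q ^_) arith ⟩
      q ^ (j ℕ.+ j ℕ.* n)          ≈⟨ ^-homo-* q j (j ℕ.* n) ⟩
      q ^ j * q ^ (j ℕ.* n)        ≈⟨ *-cong (refl {q ^ j}) (^-multiple {q} {n} qⁿ∼1 j) ⟩
      q ^ j * 1#                   ≈⟨ *-identityʳ _ ⟩
      q ^ j                        ∎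
      where
      arith : d ℕ.* j ℕ.* m ≡ j ℕ.+ j ℕ.* n
      arith = ≡.trans (comm d j m) (≡.trans (≡.cong (j ℕ.*_) dm≡1+n) (ℕ.*-suc j n))
        where
        comm : ∀ d j m → d ℕ.* j ℕ.* m ≡ j ℕ.* (d ℕ.* m)
        comm = ℕ-solve-∀

-- The parameters for d = 3 + 2h

exponent : ℕ → ℕ → ℕ
exponent h m = (3 ℕ.+ (h ℕ.+ h)) ℕ.* (m ℕ.* suc m ℕ.* suc h) ℕ.∸ 2

-- The product is written as 2 plus a natural number, so the truncated subtraction in `exponent`
-- loses nothing.
2+exponent : ∀ h m′ → 2 ℕ.+ exponent h (suc m′) ≡ (3 ℕ.+ (h ℕ.+ h)) ℕ.* (suc m′ ℕ.* suc (suc m′) ℕ.* suc h)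
2+exponent h m′ = ℕ.m+[n∸m]≡n (ℕ.≤-trans (ℕ.m≤m+n 2 _) (ℕ.≤-reflexive (expand h m′)))
  where
  expand : ∀ h m′ → 2 ℕ.+ (4 ℕ.+ 10 ℕ.* h ℕ.+ 4 ℕ.* (h ℕ.* h) ℕ.+ (3 ℕ.+ (h ℕ.+ h)) ℕ.* suc h ℕ.* (m′ ℕ.* m′ ℕ.+ 3 ℕ.* m′))
                    ≡ (3 ℕ.+ (h ℕ.+ h)) ℕ.* (suc m′ ℕ.* suc (suc m′) ℕ.* suc h)
  expand = ℕ-solve-∀

order : ℕ → ℕ → ℕ
order h m′ = suc (lastIndex (h ℕ.+ h) m′)

d*m≡1+order : ∀ h m′ → (3 ℕ.+ (h ℕ.+ h)) ℕ.* suc m′ ≡ suc (order h m′)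
d*m≡1+order = expand
  where
  expand : ∀ h m′ → (3 ℕ.+ (h ℕ.+ h)) ℕ.* suc m′ ≡ suc (suc (suc ((h ℕ.+ h) ℕ.* suc m′ ℕ.+ (m′ ℕ.+ m′) ℕ.+ m′)))
  expand = ℕ-solve-∀

[n+1]/d≡m : ∀ h m′ → (order h m′ ℕ.+ 1) div (3 ℕ.+ (h ℕ.+ h)) ≡ suc m′
[n+1]/d≡m h m′ = ≡.trans
  (ℕ./-congˡ {o = 3 ℕ.+ (h ℕ.+ h)} (≡.trans (ℕ.+-comm _ 1) (≡.trans (≡.sym (d*m≡1+order h m′)) (ℕ.*-comm (3 ℕ.+ (h ℕ.+ h)) (suc m′)))))
  (ℕ.m*n/n≡m (suc m′) (3 ℕ.+ (h ℕ.+ h)))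

-- With n + 1 = d m, the difference d(d + n)(n + 1) - (n + 1)² equals 2d · d m (m + 1)(d - 1)/2, and
-- `suc h` is (d - 1)/2. Thus the division is exact and the subtraction is not truncated.
rhsExp≡exponent : ∀ h m′ → rhsExp (3 ℕ.+ (h ℕ.+ h)) (order h m′) ≡ exponent h (suc m′)
rhsExp≡exponent h m′ = ≡.cong (ℕ._∸ 2) (≡.trans
  (ℕ./-congˡ {o = 2 ℕ.* d} (≡.trans (≡.cong (ℕ._∸ (n ℕ.+ 1) ℕ.^ 2) (expand h m′)) (ℕ.m+n∸n≡m (x ℕ.* (2 ℕ.* d)) ((n ℕ.+ 1) ℕ.^ 2))))
  (ℕ.m*n/n≡m x (2 ℕ.* d)))
  where
  d = 3 ℕ.+ (h ℕ.+ h)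
  n = order h m′
  x = d ℕ.* (suc m′ ℕ.* suc (suc m′) ℕ.* suc h)
  expand : ∀ h m′ → let d = 3 ℕ.+ (h ℕ.+ h); n = suc (suc ((h ℕ.+ h) ℕ.* suc m′ ℕ.+ (m′ ℕ.+ m′) ℕ.+ m′)) in
    d ℕ.* (d ℕ.+ n) ℕ.* (n ℕ.+ 1) ≡ d ℕ.* (suc m′ ℕ.* suc (suc m′) ℕ.* suc h) ℕ.* (2 ℕ.* d) ℕ.+ (n ℕ.+ 1) ℕ.* ((n ℕ.+ 1) ℕ.* 1)
  expand = ℕ-solve-∀

rhs≡ : ∀ h m′ → let d = 3 ℕ.+ (h ℕ.+ h) in rhs d (order h m′) ≡
  ((oneₚ -ₚ q) ^ₚ 2 *ₚ qPoch d d (degree (h ℕ.+ h) m′) *ₚ qPow (exponent h (suc m′)))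
  /ₚ (qPoch d d (suc m′) ^ₚ (2 ℕ.+ (h ℕ.+ h)))
rhs≡ h m′ = ≡.cong₂ _/ₚ_
  (≡.cong₂ (λ i j → (oneₚ -ₚ q) ^ₚ 2 *ₚ qPoch d d i *ₚ qPow j)
    (≡.trans (≡.cong (suc (M′ ℕ.+ m′) ℕ.∸_) ([n+1]/d≡m h m′)) (ℕ.m+n∸n≡m M′ m′))
    (rhsExp≡exponent h m′))
  (≡.cong (λ i → qPoch d d i ^ₚ (2 ℕ.+ (h ℕ.+ h))) ([n+1]/d≡m h m′))
  where
  d = 3 ℕ.+ (h ℕ.+ h)
  M′ = degree (h ℕ.+ h) m′

-- The congruence for d = 3 + 2h

module Congruence (Φ : ℕ → Poly) (cyclotomic : IsCyclotomicFamily Φ) (h m′ : ℕ) where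
  private
    e = h ℕ.+ h
    d = 3 ℕ.+ e
    m = suc m′
    M′ = degree e m′
    K = lastIndex e m′
    n = suc K

  open Cyclotomic Φ cyclotomic using (Φ-factor)
  open CyclotomicUnits Φ cyclotomic n (s≤s z≤n) using (unit-1-qPow)
  open PolyQuotient (Φ n ^ₚ 2)
  open CommutativeExp commutativeSemiring using (^-distrib-*)

  p = q ^ d
  ε = qPow n -ₚ oneₚ

  ε²∼0 : ε *ₚ ε ∼ []
  ε²∼0 = modulo (w *ₚ w) (≋-trans (*ₚ-cong (proj₂ (Φ-factor (s≤s z≤n))) (proj₂ (Φ-factor (s≤s z≤n))))
    (𝒮.solve 2 (λ P w → P 𝒮.:* w 𝒮.:* (P 𝒮.:* w) 𝒮.:= 𝒮.:0 𝒮.:+ P 𝒮.:* (P 𝒮.:* 𝒮.:1) 𝒮.:* (w 𝒮.:* w)) 𝒫.refl (Φ n) w))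
    where
    module 𝒮 = ℤ-Solver polyRing
    w = proj₁ (Φ-factor {n} (s≤s z≤n))

  qⁿ∼1+ε : q ^ n ∼ oneₚ +ₚ ε
  qⁿ∼1+ε = trans (sym (qPow∼q^ n)) (solve 1 (λ x → x := :1 :+ (x :- :1)) refl (qPow n))

  poch-unit : ∀ k → k ≤ K → Unit (poch p p k)
  poch-unit k k≤K = unit-poch p p k factor-unit
    where
    factor-unit : ∀ j → j ℕ.< k → Unit (oneₚ -ₚ p *ₚ p ^ j)
    -- The factor of index `j` is 1 - q^(d(j + 1)) with 0 < j + 1 ≤ K < n: a unit modulo `Φ n`,
    -- lifted to the square.
    factor-unit j j<k = unit-cong {oneₚ -ₚ qPow (d ℕ.* suc j)} {oneₚ -ₚ p *ₚ p ^ j}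
      (+-cong (refl {oneₚ}) (-‿cong (trans (qPow∼q^ (d ℕ.* suc j)) (sym (^-assocʳ q d (suc j))))))
      (unit-square {Φ n} {oneₚ -ₚ qPow (d ℕ.* suc j)} (unit-1-qPow d m (suc j) (d*m≡1+order h m′) (s≤s z≤n) (s≤s (ℕ.≤-trans j<k k≤K))))

  open Reciprocals K (poch p p) poch-unit

  den-unit : ∀ k j → k ≤ K → Unit (qPoch d d k ^ₚ j)
  den-unit k j k≤K = unit-cong (reflexive (≡.sym (^ₚ≡^ (qPoch d d k) j)))
    (unit-^ j (unit-cong (sym (qPoch∼poch d d k)) (poch-unit k k≤K)))

  den-cancel : ∀ k j → k ≤ K → qPoch d d k ^ₚ j *ₚ inv k ^ j ∼ oneₚ
  den-cancel k j k≤K = begin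
    qPoch d d k ^ₚ j *ₚ inv k ^ j       ≡⟨ ≡.cong (_*ₚ inv k ^ j) (^ₚ≡^ (qPoch d d k) j) ⟩
    qPoch d d k ^ j *ₚ inv k ^ j        ≈⟨ ^-distrib-* (qPoch d d k) (inv k) j ⟨
    (qPoch d d k *ₚ inv k) ^ j          ≈⟨ ^-congˡ j (trans (*-cong (qPoch∼poch d d k) (refl {inv k})) (inverse k k≤K)) ⟩
    oneₚ ^ j                            ≈⟨ 1^ j ⟩
    oneₚ                                ∎
    where
    1^ : ∀ j → oneₚ ^ j ∼ oneₚ
    1^ zero = refl
    1^ (suc j) = trans (*-identityˡ _) (1^ j)

  open Evaluation quotientRing
  open AtOrder q ε ε²∼0 e m′ qⁿ∼1+ε inv inverse using (summand; evaluation)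

  cancel-den : ∀ k j X → k ≤ K → X ∼ qPoch d d k ^ₚ j *ₚ (X *ₚ inv k ^ j)
  cancel-den k j X k≤K = begin
    X                                           ≈⟨ *-identityˡ X ⟨
    oneₚ *ₚ X                                   ≈⟨ *-cong (den-cancel k j k≤K) (refl {X}) ⟨
    qPoch d d k ^ₚ j *ₚ inv k ^ j *ₚ X
      ≈⟨ solve 3 (λ D i X → D :* i :* X := D :* (X :* i)) refl (qPoch d d k ^ₚ j) (inv k ^ j) X ⟩
    qPoch d d k ^ₚ j *ₚ (X *ₚ inv k ^ j)        ∎

  qPoch₁ : ∀ k → qPoch (d ℕ.+ 1) d k ∼ poch (q *ₚ p) p k
  qPoch₁ k = trans (qPoch∼poch (d ℕ.+ 1) d k)
    (poch-cong p k (reflexive (≡.cong (q ^_) (ℕ.+-comm d 1))))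

  qPoch₂ : ∀ k → qPoch 1 d k ∼ poch q p k
  qPoch₂ k = trans (qPoch∼poch 1 d k) (poch-cong p k (*-identityʳ q))

  lhsTerm-value : ∀ k → k ≤ K → num (lhsTerm d k) ∼ den (lhsTerm d k) *ₚ summand k
  lhsTerm-value k k≤K = trans (*-cong (*-cong
      (trans (reflexive (^ₚ≡^ (qPoch (d ℕ.+ 1) d k) (suc e))) (^-congˡ (suc e) (qPoch₁ k)))
      (^-congˡ 2 (qPoch₂ k)))
      (trans (qPow∼q^ (d ℕ.* k)) (sym (^-assocʳ q d k))))
    (cancel-den k d (poch (q *ₚ p) p k ^ suc e *ₚ poch q p k ^ 2 *ₚ p ^ k) k≤K)

  value : Poly
  value = (oneₚ -ₚ q) ^ 2 *ₚ poch p p M′ *ₚ q ^ exponent h m *ₚ inv m ^ (2 ℕ.+ e)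

  m≤K : m ≤ K
  m≤K = s≤s (ℕ.m≤n+m m′ M′)

  rhs-value : (oneₚ -ₚ q) ^ₚ 2 *ₚ qPoch d d M′ *ₚ qPow (exponent h m) ∼ qPoch d d m ^ₚ (2 ℕ.+ e) *ₚ value
  rhs-value = trans (*-cong (*-cong (refl {(oneₚ -ₚ q) ^ 2}) (qPoch∼poch d d M′)) (qPow∼q^ (exponent h m)))
    (cancel-den m (2 ℕ.+ e) ((oneₚ -ₚ q) ^ 2 *ₚ poch p p M′ *ₚ q ^ exponent h m) m≤K)

  δ : Poly
  δ = proj₁ (·ₚ1-unit (2 ℕ.+ e))

  δd∼1 : δ *ₚ (oneₚ +ₚ (oneₚ +ₚ (oneₚ +ₚ e · oneₚ))) ∼ oneₚ
  δd∼1 = begin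
    δ *ₚ (3 ℕ.+ e) · oneₚ       ≡⟨ ≡.cong (δ *ₚ_) (·ₚ≡· (3 ℕ.+ e)) ⟨
    δ *ₚ (3 ℕ.+ e) ·ₚ oneₚ      ≈⟨ *-comm δ _ ⟩
    (3 ℕ.+ e) ·ₚ oneₚ *ₚ δ      ≈⟨ ≈⇒∼ (proj₂ (·ₚ1-unit (2 ℕ.+ e))) ⟩
    oneₚ                        ∎

  lhs∼rhs : sum n summand ∼ value
  -- `evaluation` expects (d - 1)/2, which is `suc h` as d = 3 + 2h.
  lhs∼rhs = evaluation (suc h) (exponent h m) (≡.cong suc (≡.sym (ℕ.+-suc h h))) (2+exponent h m′) δ δd∼1

  B : Frac
  B = ((oneₚ -ₚ q) ^ₚ 2 *ₚ qPoch d d M′ *ₚ qPow (exponent h m)) /ₚ (qPoch d d m ^ₚ (2 ℕ.+ e))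

  lhs-value : num (lhs d n) ∼ den (lhs d n) *ₚ sum n summand
  lhs-value = sumF-value n (lhsTerm d) summand (λ k k<n → lhsTerm-value k (ℕ.s≤s⁻¹ k<n))

  lhs-unit : Unit (den (lhs d n))
  lhs-unit = sumF-unit n (lhsTerm d) (λ k k<n → den-unit k d (ℕ.s≤s⁻¹ k<n))

  congruence′ : CongMod (lhs d n) B (Φ n ^ₚ 2)
  congruence′ = congMod (lhs d n) B {sum n summand} {value}
    lhs-value rhs-value lhs∼rhs lhs-unit (den-unit m (2 ℕ.+ e) m≤K)

  congruence : CongMod (lhs d n) (rhs d n) (Φ n ^ₚ 2)
  congruence = ≡.subst (λ r → CongMod (lhs d n) r (Φ n ^ₚ 2)) (≡.sym (rhs≡ h m′)) congruence′

-- Odd d ≥ 3 and the general statement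

parity : ∀ k → (∃ λ h → k ≡ h ℕ.+ h) ⊎ (∃ λ h → k ≡ suc (h ℕ.+ h))
parity zero = inj₁ (0 , ≡.refl)
parity (suc k) with parity k
... | inj₁ (h , ≡.refl) = inj₂ (h , ≡.refl)
... | inj₂ (h , ≡.refl) = inj₁ (suc h , ≡.cong suc (≡.sym (ℕ.+-suc h h)))

odd≥3 : ∀ d → 3 ≤ d → ¬ (2 ∣ d) → ∃ λ h → d ≡ 3 ℕ.+ (h ℕ.+ h)
odd≥3 (suc (suc (suc k))) (s≤s (s≤s (s≤s _))) 2∤d with parity k
... | inj₁ (h , ≡.refl) = h , ≡.refl
... | inj₂ (h , ≡.refl) = contradiction (divides (2 ℕ.+ h) (expand h)) 2∤d
  where
  expand : ∀ h → 4 ℕ.+ (h ℕ.+ h) ≡ (2 ℕ.+ h) ℕ.* 2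
  expand = ℕ-solve-∀

theorem1p2 : (Φ : ℕ → Poly) → IsCyclotomicFamily Φ →
    (d n : ℕ) → 3 ≤ d → ¬ (2 ∣ d) → 1 ≤ n → d ∣ suc n →
    CongMod (lhs d n) (rhs d n) (Φ n ^ₚ 2)
theorem1p2 Φ cyclotomic d n 3≤d 2∤d 1≤n (divides zero ())
theorem1p2 Φ cyclotomic d n 3≤d 2∤d 1≤n (divides (suc m′) 1+n≡md) = at-order (odd≥3 d 3≤d 2∤d)
  where
  at-order : (∃ λ h → d ≡ 3 ℕ.+ (h ℕ.+ h)) → CongMod (lhs d n) (rhs d n) (Φ n ^ₚ 2)
  at-order (h , d≡) = ≡.subst₂ (λ d n → CongMod (lhs d n) (rhs d n) (Φ n ^ₚ 2)) (≡.sym d≡) (≡.sym n≡order)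
    (Congruence.congruence Φ cyclotomic h m′)
    where
    n≡order : n ≡ order h m′
    n≡order = ℕ.suc-injective (≡.trans 1+n≡md (≡.trans (ℕ.*-comm (suc m′) d) (≡.trans (≡.cong (ℕ._* suc m′) d≡) (d*m≡1+order h m′))))
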